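{- Let $\vec\alpha=(\alpha_i)_{i\ge1}$, $\vec\beta=(\beta_i)_{i\ge1}$ be sequences of non-negative reals and $\gamma\ge0$ a real with $\gamma+\sum_i\alpha_i+\sum_i\beta_i=1$. Then the separation distance between $k$ applications of a $(\vec\alpha,\vec\beta,\gamma)$ shuffle of an $n$ card deck and the uniform distribution on $S_n$ is at most $$\binom n2\left[\sum_i\alpha_i^2+\sum_i\beta_i^2\right]^k.$$ Thus $$k=2\log_{\frac{1}{\sum_i\alpha_i^2+\sum_i\beta_i^2}}n$$ steps suffice to get close to the uniform distribution.
   Context: **Separation distance.** The separation distance between a probability $P$ on $S_n$ and the uniform distribution $U$ is $\max_{\pi\in S_n}\left(1-\frac{P(\pi)}{U(\pi)}\right)$; it is an upper bound on total variation distance. The distribution after $k$ applications of a shuffle is the $k$-fold convolution power of the shuffle measure on the group $S_n$. **$(\vec\alpha,\vec\beta,\gamma)$ shuffle.** This is the following probability measure on $S_n$. Choose a word $w_1\cdots w_n$ of integers with independent letters: each letter equals $i>0$ with probability $\alpha_i$, equals $-i<0$ with probability $\beta_i$ ($i\geq 1$), and equals $0$ with probability $\gamma$. Process the distinct letters occurring in the word in increasing order (usual order on $\mathbb Z$), assigning to the positions of each letter the next unused block of consecutive integers from $1,2,\dots,n$ (the block having as many elements as the letter has occurrences). Within the block of a negative letter, the integers are written under its occurrences in decreasing order from left to right. Within the block of a positive letter, they are written in increasing order from left to right. Within the block of the letter $0$, they are written in a uniformly random order (independent of everything else). Then $\pi(j)$ is the integer written under $w_j$. -}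

module Defs where

open import Algebra.Bundles using (CommutativeRing; Semiring)
import Algebra.Definitions.RawSemiring as RawSemiringDefinitions
open import Data.Bool.Base using (if_then_else_)
open import Data.Fin.Base as Fin using (Fin; toℕ; fromℕ<)
import Data.Fin.Properties as Fin
open import Data.Fin.Permutation as Perm using (Permutation′; _⟨$⟩ʳ_; _∘ₚ_)
open import Data.Integer.Base as ℤ using (ℤ; 0ℤ; +0; +[1+_]; -[1+_])
import Data.Integer.Properties as ℤ
open import Data.List.Base as List
  using (List; []; _∷_; _++_; allFin; upTo; filter; length; cartesianProductWith)
open import Data.Nat.Base as ℕ using (ℕ; zero; suc; NonZero; _!)
import Data.Nat.Properties as ℕ
open import Data.Product.Base using (_×_; ∃-syntax; proj₁; proj₂)
open import Data.Sum.Base using (_⊎_)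
open import Data.Vec.Functional as Vector using (Vector)
open import Level using (Level; _⊔_) renaming (suc to lsuc)
open import Relation.Binary.Core using (Rel)
open import Relation.Binary.Lattice.Definitions using (Supremum)
open import Relation.Binary.Structures using (IsStrictPartialOrder)
open import Relation.Nullary.Decidable using (Dec; does; yes; no; _×-dec_)
open import Relation.Nullary.Negation using (¬_)

------------------------------------------------------------------------
-- Real numbers

-- The reals enter as an arbitrary Cauchy-complete Archimedean ordered
-- field.  Classically, ℝ is the only one up to isomorphism.  Order is
-- axiomatised by cotransitivity and tightness rather than by trichotomy,
-- so that constructive reals are instances too; for the same reason the
-- binary maximum is a field.

record RealField (c ℓ₁ ℓ₂ : Level) : Set (lsuc (c ⊔ ℓ₁ ⊔ ℓ₂)) where
  infix 4 _<_ _≤_ _⟶_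
  infixl 6 _∨_
  field
    commutativeRing : CommutativeRing c ℓ₁

  open CommutativeRing commutativeRing public
    renaming (Carrier to ℝ)
  open RawSemiringDefinitions (Semiring.rawSemiring semiring) public
    using (_^_; sum) renaming (_×_ to _·_)

  field
    _<_                  : Rel ℝ ℓ₂
    isStrictPartialOrder : IsStrictPartialOrder _≈_ _<_
    <-cotrans            : ∀ {x y} → x < y → ∀ z → x < z ⊎ z < y
    <-tight              : ∀ {x y} → ¬ x < y → ¬ y < x → x ≈ y
    0<1                  : 0# < 1#
    +-monoˡ-<            : ∀ {x y} z → x < y → x + z < y + z
    *-pos                : ∀ {x y} → 0# < x → 0# < y → 0# < x * y
    inverse              : ∀ {x} → 0# < x → ∃[ y ] 0# < y × x * y ≈ 1#

  _≤_ : Rel ℝ ℓ₂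
  x ≤ y = ¬ y < x

  fromℕ : ℕ → ℝ
  fromℕ n = n · 1#

  _⟶_ : (ℕ → ℝ) → ℝ → Set (c ⊔ ℓ₂)
  s ⟶ l = ∀ ε → 0# < ε →
    ∃[ N ] (∀ n → N ℕ.≤ n → l < s n + ε × s n < l + ε)

  Cauchy : (ℕ → ℝ) → Set (c ⊔ ℓ₂)
  Cauchy s = ∀ ε → 0# < ε →
    ∃[ N ] (∀ m n → N ℕ.≤ m → N ℕ.≤ n → s m < s n + ε)

  field
    _∨_          : ℝ → ℝ → ℝ
    ∨-supremum   : Supremum _≤_ _∨_
    archimedean  : ∀ x → ∃[ n ] x < fromℕ n
    complete     : ∀ s → Cauchy s → ∃[ l ] s ⟶ l

  open IsStrictPartialOrder isStrictPartialOrder public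
    using (<-respʳ-≈; <-respˡ-≈)
    renaming (irrefl to <-irrefl; trans to <-trans)

  recip : ∀ {x} → 0# < x → ℝ
  recip 0<x = proj₁ (inverse 0<x)

  recip>0 : ∀ {x} (0<x : 0# < x) → 0# < recip 0<x
  recip>0 0<x = proj₁ (proj₂ (inverse 0<x))

  fromℕ>0 : ∀ n → .{{NonZero n}} → 0# < fromℕ n
  fromℕ>0 (suc zero)    = <-respʳ-≈ (sym (+-identityʳ 1#)) 0<1
  fromℕ>0 (suc (suc n)) =
    <-trans (fromℕ>0 (suc n))
      (<-respˡ-≈ (+-identityˡ _) (+-monoˡ-< (fromℕ (suc n)) 0<1))

  1/ : ∀ n → .{{NonZero n}} → ℝ
  1/ n = recip (fromℕ>0 n)

  HasSum : (ℕ → ℝ) → ℝ → Set (c ⊔ ℓ₂)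
  HasSum f s = (λ N → sum {N} (λ i → f (toℕ i))) ⟶ s

  -- y is the logarithm of x to base b, for 1 < b and 1 ≤ x:
  -- y = sup { p / q ∣ b ^ (p / q) ≤ x }.
  IsLog : (b x y : ℝ) → Set (c ⊔ ℓ₂)
  IsLog b x y = UpperBound y × (∀ u → UpperBound u → y ≤ u)
    where
    UpperBound : ℝ → Set ℓ₂
    UpperBound u = ∀ p q → .{{_ : NonZero q}} →
      b ^ p ≤ x ^ q → fromℕ p * 1/ q ≤ u

------------------------------------------------------------------------
-- Permutations

-- Every element of Sₙ exactly once (up to pointwise equality).
allPerms : ∀ n → List (Permutation′ n)
allPerms zero    = Perm.id ∷ []
allPerms (suc n) =
  cartesianProductWith (Perm.insert Fin.zero) (allFin (suc n)) (allPerms n)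

_≈ₚ?_ : ∀ {n} (π σ : Permutation′ n) → Dec (π Perm.≈ σ)
π ≈ₚ? σ = Fin.all? λ j → (π ⟨$⟩ʳ j) Fin.≟ (σ ⟨$⟩ʳ j)

-- The action of σ on ℕ, extended by the identity.
_at_ : ∀ {m} → Permutation′ m → ℕ → ℕ
_at_ {m} σ r with r ℕ.<? m
... | yes r<m = toℕ (σ ⟨$⟩ʳ fromℕ< r<m)
... | no  _   = r

------------------------------------------------------------------------
-- From words to permutations

Word : ℕ → Set
Word n = Vector ℤ n

module _ {n} (w : Word n) where

  zeros : ℕ
  zeros = length (filter (λ i → w i ℤ.≟ 0ℤ) (allFin n))

  module _ (j : Fin n) where

    smaller : ℕ
    smaller = length (filter (λ i → w i ℤ.<? w j) (allFin n))

    equalLeft : ℕ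
    equalLeft =
      length (filter (λ i → (w i ℤ.≟ w j) ×-dec (i Fin.<? j)) (allFin n))

    equalRight : ℕ
    equalRight =
      length (filter (λ i → (w i ℤ.≟ w j) ×-dec (j Fin.<? i)) (allFin n))

    -- The integer (counting from 0) written under position j, when the
    -- block of the letter 0 is written in the order given by σ.  The block
    -- of the letter w j starts at `smaller`.
    written : Permutation′ zeros → ℕ
    written σ with w j
    ... | +[1+ _ ] = smaller ℕ.+ equalLeft
    ... | -[1+ _ ] = smaller ℕ.+ equalRight
    ... | +0       = smaller ℕ.+ σ at equalLeft

  -- The number of orders of the zero block which produce π.
  orders : Permutation′ n → ℕ
  orders π = length (filter
    (λ σ → Fin.all? λ j → toℕ (π ⟨$⟩ʳ j) ℕ.≟ written j σ)
    (allPerms zeros))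

letters : ℕ → List ℤ
letters N = 0ℤ ∷ List.map +[1+_] (upTo N) ++ List.map -[1+_] (upTo N)

-- Words of length n with letters in { -N , … , N }.
words : ℕ → ∀ n → List (Word n)
words N zero    = Vector.[] ∷ []
words N (suc n) = cartesianProductWith Vector._∷_ (letters N) (words N n)

------------------------------------------------------------------------
-- Shuffles

module Shuffles {c ℓ₁ ℓ₂} (R : RealField c ℓ₁ ℓ₂) where
  open RealField R

  !>0 : ∀ n → 0# < fromℕ (n !)
  !>0 n = fromℕ>0 (n !) {{n ℕ.!≢0}}

  sumOver : ∀ {a} {A : Set a} → List A → (A → ℝ) → ℝ
  sumOver xs f = List.foldr (λ x s → f x + s) 0# xs

  -- Real-valued functions on Sₙ
  Weight : ℕ → Set c
  Weight n = Permutation′ n → ℝ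

  -- α i and β i are the probabilities of the letters i + 1 and - (i + 1).
  module _ (α β : ℕ → ℝ) (γ : ℝ) where

    letterProb : ℤ → ℝ
    letterProb +[1+ i ] = α i
    letterProb -[1+ i ] = β i
    letterProb +0       = γ

    wordProb : ∀ {n} → Word n → ℝ
    wordProb w = Vector.foldr (λ x p → letterProb x * p) 1# w

    -- The probability of π given the word w.
    givenWord : ∀ {n} → Word n → Weight n
    givenWord w π = fromℕ (orders w π) * recip (!>0 (zeros w))

    -- P π = ∑_{w ∈ ℤⁿ} wordProb w * givenWord w π, the non-negative series
    -- being summed along the exhaustion of ℤⁿ by the boxes { -N , … , N }ⁿ.
    IsShuffle : ∀ n → Weight n → Set (c ⊔ ℓ₂)
    IsShuffle n P = ∀ π →
      (λ N → sumOver (words N n) (λ w → wordProb w * givenWord w π)) ⟶ P π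

  _⋆_ : ∀ {n} → Weight n → Weight n → Weight n
  (P ⋆ Q) π = sumOver (allPerms _) (λ σ → P σ * Q (π ∘ₚ Perm.flip σ))

  -- The distribution after k independent steps; `π ∘ₚ flip σ` applies π
  -- first, so it is σ⁻¹π in the usual notation.
  _⋆^_ : ∀ {n} → Weight n → ℕ → Weight n
  (P ⋆^ zero)  π = if does (π ≈ₚ? Perm.id) then 1# else 0#
  (P ⋆^ suc k) π = (P ⋆ (P ⋆^ k)) π

  uniform : ∀ n → Weight n
  uniform n _ = recip (!>0 n)

  uniform>0 : ∀ n π → 0# < uniform n π
  uniform>0 n _ = recip>0 (!>0 n)

  -- The identity supplies the initial value for a maximum over all of Sₙ.
  separation : ∀ {n} → Weight n → ℝ
  separation {n} P =
    List.foldr (λ π → deficit π ∨_) (deficit Perm.id) (allPerms n)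
    where
    deficit : Weight n
    deficit π = 1# - P π * recip (uniform>0 n π)

{-# OPTIONS --safe #-}
-- Read π(j) as the new position of card j: a step gives independent letters to
-- the cards and sorts them.
-- Call two cards separated once some step gives them different letters, or gives
-- both the letter 0.  A fixed pair stays unseparated for k steps with probability
-- (∑ αᵢ² + ∑ βᵢ²)^k, so all pairs are separated except with probability at most
-- (n choose 2) (∑ αᵢ² + ∑ βᵢ²)^k.  On the event that all pairs are separated the
-- permutation is uniform: exchanging two adjacent cards i, i + 1 preserves the
-- law, because cards which are not separated by a step remain neighbours, and in
-- the first step which separates them exchanging their letters (or their places
-- in the zero block) exchanges their positions and nothing else.
--
-- To avoid infinite sums the argument is run with letters in { -N , … , N },
-- where the truncated shuffle has mass less than 1 but bounds the actual one from
-- below; then N → ∞.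

module Submission where

open import Defs
open import Algebra.Bundles using (CommutativeSemiring)
import Algebra.Definitions.RawSemiring as RawSemiringDefinitions
import Algebra.Properties.CommutativeMonoid.Sum as CommutativeMonoidSum
import Algebra.Properties.CommutativeSemiring.Exp as CommutativeExp
import Algebra.Properties.Monoid.Mult as Mult
import Algebra.Properties.Semiring.Exp as Exp
import Algebra.Properties.Semiring.Mult as SemiringMult
import Algebra.Solver.Ring.NaturalCoefficients.Default as Solver
open import Data.Bool.Base using (Bool; true; false; _∧_; not) renaming (_∨_ to _or_)
import Data.Bool.Properties as Bool
open import Data.Fin.Base as Fin using (Fin; zero; suc; toℕ; fromℕ<; punchIn; punchOut)
open import Data.Fin.Permutation as Perm
  using (Permutation′; _⟨$⟩ʳ_; _⟨$⟩ˡ_; _∘ₚ_; flip; transpose)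
open import Data.Fin.Permutation.Transposition.List using (decompose; eval; eval-decompose)
import Data.Fin.Properties as Fin
open import Data.Integer.Base as ℤ using (ℤ; 0ℤ; +0; +[1+_]; -[1+_])
import Data.Integer.Properties as ℤ
open import Data.List.Base as List
  using (List; []; _∷_; _++_; allFin; tabulate; upTo; filter; length; cartesianProductWith)
import Data.List.Properties as List
open import Data.List.Relation.Unary.All as All using (All; []; _∷_)
import Data.List.Relation.Unary.All.Properties as All
open import Data.Nat.Base as ℕ using (ℕ; zero; suc; _!)
open import Data.Nat.Combinatorics using (_C_; nC1≡n; nCk+nC[k+1]≡[n+1]C[k+1])
import Data.Nat.Properties as ℕ
open import Data.Nat.Tactic.RingSolver using (solve-∀)
open import Data.Product.Base using (_×_; _,_; proj₁; proj₂; ∃-syntax)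
open import Data.Sum.Base as Sum using (_⊎_; inj₁; inj₂)
open import Data.Vec.Functional as Vector using (Vector)
open import Function.Base using (_∘_; id)
open import Function.Bundles using (mk⇔)
open import Function.Definitions using (Injective)
open import Level using (Level)
open import Relation.Binary.Bundles using (Preorder)
open import Relation.Binary.Definitions using (tri<; tri≈; tri>)
open import Relation.Binary.PropositionalEquality as ≡ using (_≡_; _≢_)
import Relation.Binary.Reasoning.Preorder as PreorderReasoning
import Relation.Binary.Reasoning.Setoid as SetoidReasoning
open import Relation.Nullary.Decidable
  using (Dec; does; yes; no; dec-true; dec-false; does-⇔; _×-dec_; _⊎-dec_; _because_)
open import Relation.Nullary.Negation using (¬_; contradiction)
open import Relation.Nullary.Reflects using (invert)
open import Relation.Unary using (Pred; Decidable)

-- Separation distance is one-sided: an upper bound on it is a lower bound on the probability of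
-- each single permutation. Both losses in the argument, of words with a letter outside the cut-off
-- and of outcomes with an unseparated pair, only lower these probabilities, so they need estimating
-- in total and never pointwise: what remains is constant on `Sₙ`, and its value is its total mass
-- divided by `n !`. For the induction on the number of steps the set of all pairs is too special,
-- because after one step some pairs are done with and the others have moved. Hence `Q` carries an
-- arbitrary relation `E` of pairs still to be separated, transported along with the cards. The
-- exchange argument looks at the first separating step, so its recursion strips off first steps,
-- opposite to that of `⋆^`. The order of the reals is not assumed decidable. Cases are
-- distinguished on words and permutations, and `≤` is a negation, so that inequalities may be
-- proved by contradiction.

private
  variable
    ℓ ℓ′ ℓ″ : Level
    A : Set ℓ
    B : Set ℓ′
    m n : ℕ

-- Sums over lists

module ListSum {c ℓ} (S : CommutativeSemiring c ℓ) where
  open CommutativeSemiring S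
  open RawSemiringDefinitions rawSemiring using () renaming (_×_ to _·_)
  open SetoidReasoning setoid

  -- Over any commutative semiring, because the same identities serve in ℕ, to count orders of the
  -- zero block, and in ℝ, for probabilities. Over ℝ this unfolds to the same fold as `sumOver`.
  ∑ : List A → (A → Carrier) → Carrier
  ∑ xs f = List.foldr (λ x s → f x + s) 0# xs

  ⟦_⟧ : Bool → Carrier
  ⟦ true ⟧  = 1#
  ⟦ false ⟧ = 0#

  ⟦∧⟧ : ∀ p q → ⟦ p ∧ q ⟧ ≈ ⟦ p ⟧ * ⟦ q ⟧
  ⟦∧⟧ true  q = sym (*-identityˡ _)
  ⟦∧⟧ false q = sym (zeroˡ _)

  ⟦⟧-cong : ∀ {p q} → p ≡ q → ⟦ p ⟧ ≈ ⟦ q ⟧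
  ⟦⟧-cong ≡.refl = refl

  ⟦⟧-⇔ : ∀ (A? : Dec A) (B? : Dec B) → (A → B) → (B → A) →
         ⟦ does A? ⟧ ≈ ⟦ does B? ⟧
  ⟦⟧-⇔ A? B? to from = ⟦⟧-cong (does-⇔ (mk⇔ to from) A? B?)

  ∑-cong : ∀ (xs : List A) {f g} → (∀ x → f x ≈ g x) → ∑ xs f ≈ ∑ xs g
  ∑-cong []       f≈g = refl
  ∑-cong (x ∷ xs) f≈g = +-cong (f≈g x) (∑-cong xs f≈g)

  ∑-cong-All : ∀ {p} {P : Pred A p} {xs f g} → All P xs →
               (∀ {x} → P x → f x ≈ g x) → ∑ xs f ≈ ∑ xs g
  ∑-cong-All []         f≈g = refl
  ∑-cong-All (px ∷ pxs) f≈g = +-cong (f≈g px) (∑-cong-All pxs f≈g)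

  ∑-zero : ∀ (xs : List A) → ∑ xs (λ _ → 0#) ≈ 0#
  ∑-zero []       = refl
  ∑-zero (x ∷ xs) = trans (+-identityˡ _) (∑-zero xs)

  ∑-distrib-+ : ∀ (xs : List A) f g → ∑ xs (λ x → f x + g x) ≈ ∑ xs f + ∑ xs g
  ∑-distrib-+ []       f g = sym (+-identityˡ _)
  ∑-distrib-+ (x ∷ xs) f g = begin
    (f x + g x) + ∑ xs (λ x → f x + g x) ≈⟨ +-congˡ (∑-distrib-+ xs f g) ⟩
    (f x + g x) + (∑ xs f + ∑ xs g)      ≈⟨ +-assoc _ _ _ ⟩
    f x + (g x + (∑ xs f + ∑ xs g))      ≈⟨ +-congˡ (sym (+-assoc _ _ _)) ⟩
    f x + ((g x + ∑ xs f) + ∑ xs g)      ≈⟨ +-congˡ (+-congʳ (+-comm _ _)) ⟩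
    f x + ((∑ xs f + g x) + ∑ xs g)      ≈⟨ +-congˡ (+-assoc _ _ _) ⟩
    f x + (∑ xs f + (g x + ∑ xs g))      ≈⟨ sym (+-assoc _ _ _) ⟩
    (f x + ∑ xs f) + (g x + ∑ xs g)      ∎

  *-distribˡ-∑ : ∀ c (xs : List A) f → c * ∑ xs f ≈ ∑ xs (λ x → c * f x)
  *-distribˡ-∑ c []       f = zeroʳ c
  *-distribˡ-∑ c (x ∷ xs) f = trans (distribˡ c _ _) (+-congˡ (*-distribˡ-∑ c xs f))

  *-distribʳ-∑ : ∀ c (xs : List A) f → ∑ xs f * c ≈ ∑ xs (λ x → f x * c)
  *-distribʳ-∑ c []       f = zeroˡ c
  *-distribʳ-∑ c (x ∷ xs) f = trans (distribʳ c _ _) (+-congˡ (*-distribʳ-∑ c xs f))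

  ∑-swap : ∀ (xs : List A) (ys : List B) (f : A → B → Carrier) →
           ∑ xs (λ x → ∑ ys (λ y → f x y)) ≈ ∑ ys (λ y → ∑ xs (λ x → f x y))
  ∑-swap []       ys f = sym (∑-zero ys)
  ∑-swap (x ∷ xs) ys f = trans (+-congˡ (∑-swap xs ys f)) (sym (∑-distrib-+ ys _ _))

  ∑-++ : ∀ (xs ys : List A) f → ∑ (xs ++ ys) f ≈ ∑ xs f + ∑ ys f
  ∑-++ []       ys f = sym (+-identityˡ _)
  ∑-++ (x ∷ xs) ys f = trans (+-congˡ (∑-++ xs ys f)) (sym (+-assoc _ _ _))

  ∑-map : ∀ (h : A → B) xs f → ∑ (List.map h xs) f ≡ ∑ xs (f ∘ h)
  ∑-map h []       f = ≡.refl
  ∑-map h (x ∷ xs) f = ≡.cong (f (h x) +_) (∑-map h xs f)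

  ∑-cartesianProductWith : ∀ {d} {C : Set d} (h : A → B → C) xs ys f →
    ∑ (cartesianProductWith h xs ys) f ≈ ∑ xs (λ x → ∑ ys (λ y → f (h x y)))
  ∑-cartesianProductWith h []       ys f = refl
  ∑-cartesianProductWith h (x ∷ xs) ys f = trans (∑-++ (List.map (h x) ys) _ f)
    (+-cong (reflexive (∑-map (h x) ys f)) (∑-cartesianProductWith h xs ys f))

  ∑-tabulate : ∀ n (h : Fin n → A) f → ∑ (tabulate h) f ≡ ∑ (allFin n) (f ∘ h)
  ∑-tabulate ℕ.zero    h f = ≡.refl
  ∑-tabulate (ℕ.suc n) h f = ≡.cong (f (h Fin.zero) +_)
    (≡.trans (∑-tabulate n (h ∘ Fin.suc) f) (≡.sym (∑-tabulate n Fin.suc (f ∘ h))))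

  ∑-allFin-suc : ∀ n f → ∑ (allFin (ℕ.suc n)) f ≡ f Fin.zero + ∑ (allFin n) (f ∘ Fin.suc)
  ∑-allFin-suc n f = ≡.cong (f Fin.zero +_) (∑-tabulate n Fin.suc f)

  length-filter : ∀ {p} {P : Pred A p} (P? : Decidable P) xs →
                  length (filter P? xs) · 1# ≈ ∑ xs (λ x → ⟦ does (P? x) ⟧)
  length-filter P? []       = refl
  length-filter P? (x ∷ xs) with does (P? x)
  ... | true  = +-congˡ (length-filter P? xs)
  ... | false = trans (length-filter P? xs) (sym (+-identityˡ _))

  ∑-const : ∀ (xs : List A) → ∑ xs (λ _ → 1#) ≡ length xs · 1#
  ∑-const []       = ≡.refl
  ∑-const (x ∷ xs) = ≡.cong (1# +_) (∑-const xs)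

  -- Double counting along a relation which matches the elements of xs with
  -- those of ys.
  ∑-reindex : ∀ (r : A → B → Bool) xs ys {f g} →
    All (λ x → ∑ ys (λ y → ⟦ r x y ⟧) ≈ 1#) xs →
    All (λ y → ∑ xs (λ x → ⟦ r x y ⟧) ≈ 1#) ys →
    (∀ x y → r x y ≡ true → f x ≈ g y) →
    ∑ xs f ≈ ∑ ys g
  ∑-reindex r xs ys {f} {g} one oneʳ f≈g = begin
    ∑ xs f
      ≈⟨ ∑-cong-All one (λ p → trans (sym (*-identityʳ _)) (*-congˡ (sym p))) ⟩
    ∑ xs (λ x → f x * ∑ ys (λ y → ⟦ r x y ⟧))
      ≈⟨ ∑-cong xs (λ x → *-distribˡ-∑ (f x) ys (λ y → ⟦ r x y ⟧)) ⟩
    ∑ xs (λ x → ∑ ys (λ y → f x * ⟦ r x y ⟧))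
      ≈⟨ ∑-cong xs (λ x → ∑-cong ys (λ y → match x y)) ⟩
    ∑ xs (λ x → ∑ ys (λ y → g y * ⟦ r x y ⟧))
      ≈⟨ ∑-swap xs ys _ ⟩
    ∑ ys (λ y → ∑ xs (λ x → g y * ⟦ r x y ⟧))
      ≈⟨ ∑-cong ys (λ y → sym (*-distribˡ-∑ (g y) xs (λ x → ⟦ r x y ⟧))) ⟩
    ∑ ys (λ y → g y * ∑ xs (λ x → ⟦ r x y ⟧))
      ≈⟨ ∑-cong-All oneʳ (λ p → trans (*-congˡ p) (*-identityʳ _)) ⟩
    ∑ ys g ∎
    where
    match : ∀ x y → f x * ⟦ r x y ⟧ ≈ g y * ⟦ r x y ⟧
    match x y with r x y in eq
    ... | true  = *-congʳ (f≈g x y eq)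
    ... | false = trans (zeroʳ _) (sym (zeroʳ _))

-- Permutations

does-true⇒ : (A? : Dec A) → does A? ≡ true → A
does-true⇒ (true because p) _ = invert p

transpose-ˡ : ∀ (i j : Fin n) → transpose i j ⟨$⟩ʳ i ≡ j
transpose-ˡ i j rewrite dec-true (i Fin.≟ i) ≡.refl = ≡.refl

transpose-ʳ : ∀ (i j : Fin n) → transpose i j ⟨$⟩ʳ j ≡ i
transpose-ʳ i j with j Fin.≟ i
... | yes j≡i = j≡i
... | no _ rewrite dec-true (j Fin.≟ j) ≡.refl = ≡.refl

transpose-other : ∀ (i j : Fin n) {k} → k ≢ i → k ≢ j → transpose i j ⟨$⟩ʳ k ≡ k
transpose-other i j {k} k≢i k≢j
  rewrite dec-false (k Fin.≟ i) k≢i | dec-false (k Fin.≟ j) k≢j = ≡.refl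

-- The last index is the image of the one before it, so matching on a view also replaces the image
-- in the goal by its value.
data View (i j : Fin n) : Fin n → Fin n → Set where
  atˡ   : View i j i j
  atʳ   : View i j j i
  other : ∀ {k} → k ≢ i → k ≢ j → View i j k k

view : ∀ (i j k : Fin n) → View i j k (transpose i j ⟨$⟩ʳ k)
view i j k with k Fin.≟ i
... | yes ≡.refl = atˡ
... | no k≢i with k Fin.≟ j
...   | yes ≡.refl = atʳ
...   | no k≢j     = other k≢i k≢j

transpose-involutive : ∀ (i j k : Fin n) →
  transpose i j ⟨$⟩ʳ (transpose i j ⟨$⟩ʳ k) ≡ k
transpose-involutive i j k with transpose i j ⟨$⟩ʳ k | view i j k
... | _ | atˡ           = transpose-ʳ i j
... | _ | atʳ           = transpose-ˡ i j
... | _ | other k≢i k≢j = transpose-other i j k≢i k≢j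

permutation-injective : ∀ (τ : Permutation′ n) {i j} → τ ⟨$⟩ʳ i ≡ τ ⟨$⟩ʳ j → i ≡ j
permutation-injective τ {i} {j} eq =
  ≡.trans (≡.sym (Perm.inverseˡ τ)) (≡.trans (≡.cong (τ ⟨$⟩ˡ_) eq) (Perm.inverseˡ τ))

-- This carries an exchange of cards through a step: exchanging `i` and `j` before `τ` amounts to
-- exchanging their new positions after it.
transpose-conjugate : ∀ (τ : Permutation′ n) i j k →
  τ ⟨$⟩ʳ (transpose i j ⟨$⟩ʳ k) ≡ transpose (τ ⟨$⟩ʳ i) (τ ⟨$⟩ʳ j) ⟨$⟩ʳ (τ ⟨$⟩ʳ k)
transpose-conjugate τ i j k with transpose i j ⟨$⟩ʳ k | view i j k
... | _ | atˡ           = ≡.sym (transpose-ˡ (τ ⟨$⟩ʳ i) (τ ⟨$⟩ʳ j))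
... | _ | atʳ           = ≡.sym (transpose-ʳ (τ ⟨$⟩ʳ i) (τ ⟨$⟩ʳ j))
... | _ | other k≢i k≢j = ≡.sym (transpose-other (τ ⟨$⟩ʳ i) (τ ⟨$⟩ʳ j)
  (k≢i ∘ permutation-injective τ) (k≢j ∘ permutation-injective τ))

infix 4 _≗?_
_≗?_ : ∀ (f g : Fin m → Fin n) → Dec (∀ i → f i ≡ g i)
f ≗? g = Fin.all? λ i → f i Fin.≟ g i

-- Sums over all positions and over all permutations

module Enumeration {c ℓ} (S : CommutativeSemiring c ℓ) where
  open CommutativeSemiring S hiding (zero)
  open ListSum S
  open SetoidReasoning setoid

  ∑-δ-allFin : ∀ n (i : Fin n) → ∑ (allFin n) (λ j → ⟦ does (i Fin.≟ j) ⟧) ≈ 1#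
  ∑-δ-allFin (suc n) zero = trans (reflexive (∑-allFin-suc n _))
    (trans (+-congˡ (∑-zero (allFin n))) (+-identityʳ _))
  ∑-δ-allFin (suc n) (suc i) = trans (reflexive (∑-allFin-suc n _))
    (trans (+-identityˡ _) (∑-δ-allFin n i))

  ∑-δ-allFinʳ : ∀ n (i : Fin n) → ∑ (allFin n) (λ j → ⟦ does (j Fin.≟ i) ⟧) ≈ 1#
  ∑-δ-allFinʳ n i = trans
    (∑-cong (allFin n) λ j → ⟦⟧-⇔ (j Fin.≟ i) (i Fin.≟ j) ≡.sym ≡.sym)
    (∑-δ-allFin n i)

  ∑-permute : ∀ (s : Permutation′ n) {f g} → (∀ i → f i ≈ g (s ⟨$⟩ʳ i)) →
              ∑ (allFin n) f ≈ ∑ (allFin n) g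
  ∑-permute {n} s {f} {g} f≈g = ∑-reindex (λ i j → does (s ⟨$⟩ʳ i Fin.≟ j)) (allFin n) (allFin n)
    (All.universal (λ i → ∑-δ-allFin n (s ⟨$⟩ʳ i)) _)
    (All.universal (λ j → trans
      (∑-cong (allFin n) λ i → ⟦⟧-⇔ (s ⟨$⟩ʳ i Fin.≟ j) (s ⟨$⟩ˡ j Fin.≟ i)
        (λ p → ≡.trans (≡.cong (s ⟨$⟩ˡ_) (≡.sym p)) (Perm.inverseˡ s))
        (λ p → ≡.trans (≡.cong (s ⟨$⟩ʳ_) (≡.sym p)) (Perm.inverseʳ s)))
      (∑-δ-allFin n (s ⟨$⟩ˡ j))) _)
    (λ i j p → trans (f≈g i) (reflexive (≡.cong g (does-true⇒ (s ⟨$⟩ʳ i Fin.≟ j) p))))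

  -- An inserted permutation consists of a value at `zero` and a permutation of the rest, so
  -- agreement with `f` splits into one condition on each, the second for `f` with the value
  -- `f zero` punched out. This count is what lets sums over `allPerms` be reindexed although
  -- permutations can be compared only pointwise.
  ∑-δ-allPerms : ∀ n (f : Fin n → Fin n) → Injective _≡_ _≡_ f →
                 ∑ (allPerms n) (λ π → ⟦ does ((π ⟨$⟩ʳ_) ≗? f) ⟧) ≈ 1#
  ∑-δ-allPerms zero    f inj = +-identityʳ 1#
  ∑-δ-allPerms (suc n) f inj = begin
    ∑ (allPerms (suc n)) (λ π → ⟦ does ((π ⟨$⟩ʳ_) ≗? f) ⟧)
      ≈⟨ ∑-cartesianProductWith (Perm.insert zero) (allFin (suc n)) (allPerms n) _ ⟩
    ∑ (allFin (suc n)) (λ i → ∑ (allPerms n) λ π →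
      ⟦ does ((Perm.insert zero i π ⟨$⟩ʳ_) ≗? f) ⟧)
      ≈⟨ ∑-cong (allFin (suc n)) (λ i → ∑-cong (allPerms n) λ π →
           trans (⟦⟧-⇔ ((Perm.insert zero i π ⟨$⟩ʳ_) ≗? f)
             ((i Fin.≟ f zero) ×-dec ((π ⟨$⟩ʳ_) ≗? g)) (to i π) (from i π))
             (⟦∧⟧ (does (i Fin.≟ f zero)) _)) ⟩
    ∑ (allFin (suc n)) (λ i → ∑ (allPerms n) λ π →
      ⟦ does (i Fin.≟ f zero) ⟧ * ⟦ does ((π ⟨$⟩ʳ_) ≗? g) ⟧)
      ≈⟨ ∑-cong (allFin (suc n)) (λ i → trans
           (sym (*-distribˡ-∑ ⟦ does (i Fin.≟ f zero) ⟧ (allPerms n) (λ π → ⟦ does ((π ⟨$⟩ʳ_) ≗? g) ⟧)))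
           (trans (*-congˡ (∑-δ-allPerms n g g-injective)) (*-identityʳ _))) ⟩
    ∑ (allFin (suc n)) (λ i → ⟦ does (i Fin.≟ f zero) ⟧)
      ≈⟨ ∑-δ-allFinʳ (suc n) (f zero) ⟩
    1# ∎
    where
    f0≢ : ∀ k → f zero ≢ f (suc k)
    f0≢ k eq with () ← inj eq
    g : Fin n → Fin n
    g k = punchOut (f0≢ k)
    g-injective : Injective _≡_ _≡_ g
    g-injective eq = Fin.suc-injective (inj (Fin.punchOut-injective (f0≢ _) (f0≢ _) eq))
    to : ∀ i π → (∀ k → Perm.insert zero i π ⟨$⟩ʳ k ≡ f k) →
         i ≡ f zero × (∀ k → π ⟨$⟩ʳ k ≡ g k)
    to i π eq = eq zero , λ k → Fin.punchIn-injective (f zero) _ _ (≡.trans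
      (≡.cong (λ l → punchIn l (π ⟨$⟩ʳ k)) (≡.sym (eq zero)))
      (≡.trans (eq (suc k)) (≡.sym (Fin.punchIn-punchOut (f0≢ k)))))
    from : ∀ i π → i ≡ f zero × (∀ k → π ⟨$⟩ʳ k ≡ g k) →
           ∀ k → Perm.insert zero i π ⟨$⟩ʳ k ≡ f k
    from i π (eq , eqs) zero    = eq
    from i π (eq , eqs) (suc k) = ≡.trans (≡.cong₂ punchIn eq (eqs k))
      (Fin.punchIn-punchOut (f0≢ k))

  -- The entry of `allPerms` that represents `s ∘ₚ τ` is only pointwise equal to it, hence the
  -- hypothesis about all `τ′` with the same values.
  ∑-precompose : ∀ (s : Permutation′ n) {f g} →
    (∀ τ τ′ → (∀ j → τ′ ⟨$⟩ʳ j ≡ τ ⟨$⟩ʳ (s ⟨$⟩ʳ j)) → f τ ≈ g τ′) →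
    ∑ (allPerms n) f ≈ ∑ (allPerms n) g
  ∑-precompose {n} s f≈g = ∑-reindex
    (λ τ τ′ → does ((τ′ ⟨$⟩ʳ_) ≗? (s ∘ₚ τ ⟨$⟩ʳ_))) (allPerms n) (allPerms n)
    (All.universal (λ τ → ∑-δ-allPerms n _ (permutation-injective (s ∘ₚ τ))) _)
    (All.universal (λ τ′ → trans
      (∑-cong (allPerms n) λ τ → ⟦⟧-⇔
        ((τ′ ⟨$⟩ʳ_) ≗? (s ∘ₚ τ ⟨$⟩ʳ_)) ((τ ⟨$⟩ʳ_) ≗? (flip s ∘ₚ τ′ ⟨$⟩ʳ_))
        (λ eq j → ≡.trans (≡.cong (τ ⟨$⟩ʳ_) (≡.sym (Perm.inverseʳ s))) (≡.sym (eq _)))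
        (λ eq j → ≡.trans (≡.cong (τ′ ⟨$⟩ʳ_) (≡.sym (Perm.inverseˡ s))) (≡.sym (eq _))))
      (∑-δ-allPerms n _ (permutation-injective (flip s ∘ₚ τ′)))) _)
    (λ τ τ′ p → f≈g τ τ′ (does-true⇒ ((τ′ ⟨$⟩ʳ_) ≗? (s ∘ₚ τ ⟨$⟩ʳ_)) p))

length-cartesianProductWith : ∀ {B C : Set} (h : A → B → C) xs ys →
  length (cartesianProductWith h xs ys) ≡ length xs ℕ.* length ys
length-cartesianProductWith h []       ys = ≡.refl
length-cartesianProductWith h (x ∷ xs) ys = ≡.trans (List.length-++ (List.map (h x) ys))
  (≡.cong₂ ℕ._+_ (List.length-map (h x) ys) (length-cartesianProductWith h xs ys))

length-allPerms : ∀ n → length (allPerms n) ≡ n !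
length-allPerms zero    = ≡.refl
length-allPerms (suc n) = ≡.trans
  (length-cartesianProductWith (Perm.insert zero) (allFin (suc n)) (allPerms n))
  (≡.cong₂ ℕ._*_ (List.length-tabulate {n = suc n} id) (length-allPerms n))

-- Words and the permutations they produce

module Orders where

  open ListSum ℕ.+-*-commutativeSemiring
  open Enumeration ℕ.+-*-commutativeSemiring

  ∑-mono : ∀ (xs : List A) {f g} → (∀ x → f x ℕ.≤ g x) → ∑ xs f ℕ.≤ ∑ xs g
  ∑-mono []       f≤g = ℕ.z≤n
  ∑-mono (x ∷ xs) f≤g = ℕ.+-mono-≤ (f≤g x) (∑-mono xs f≤g)

  ∣_∣ : {P : Pred (Fin n) ℓ} → Decidable P → ℕ
  ∣ P? ∣ = length (filter P? (allFin _))

  length-filter′ : ∀ {P : Pred A ℓ′} (P? : Decidable P) xs →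
                   length (filter P? xs) ≡ ∑ xs (λ x → ⟦ does (P? x) ⟧)
  length-filter′ P? xs = ≡.trans (≡.sym (×1 _)) (length-filter P? xs)
    where
    open RawSemiringDefinitions ℕ.+-*-rawSemiring using () renaming (_×_ to _·_)
    ×1 : ∀ k → k · 1 ≡ k
    ×1 zero    = ≡.refl
    ×1 (suc k) = ≡.cong suc (×1 k)

  module _ {P : Pred (Fin n) ℓ} {Q : Pred (Fin n) ℓ′} (P? : Decidable P) (Q? : Decidable Q) where

    ∣∣-permute : ∀ (s : Permutation′ n) → (∀ i → P i → Q (s ⟨$⟩ʳ i)) →
                 (∀ i → Q (s ⟨$⟩ʳ i) → P i) → ∣ P? ∣ ≡ ∣ Q? ∣
    ∣∣-permute s to from = begin
      ∣ P? ∣                                ≡⟨ length-filter′ P? (allFin n) ⟩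
      ∑ (allFin n) (λ i → ⟦ does (P? i) ⟧)  ≡⟨ ∑-permute s (λ i →
        ⟦⟧-⇔ (P? i) (Q? (s ⟨$⟩ʳ i)) (to i) (from i)) ⟩
      ∑ (allFin n) (λ i → ⟦ does (Q? i) ⟧)  ≡⟨ length-filter′ Q? (allFin n) ⟨
      ∣ Q? ∣ ∎
      where open ≡.≡-Reasoning

    module _ {R : Pred (Fin n) ℓ″} (R? : Decidable R)
             (P⇒R : ∀ i → P i → R i) (Q⇒R : ∀ i → Q i → R i) (P⇒¬Q : ∀ i → P i → ¬ Q i) where

      private
        lhs : ∣ P? ∣ ℕ.+ ∣ Q? ∣ ≡ ∑ (allFin n) (λ i → ⟦ does (P? i) ⟧ ℕ.+ ⟦ does (Q? i) ⟧)
        lhs = ≡.trans (≡.cong₂ ℕ._+_ (length-filter′ P? (allFin n)) (length-filter′ Q? (allFin n)))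
          (≡.sym (∑-distrib-+ (allFin n) (λ i → ⟦ does (P? i) ⟧) (λ i → ⟦ does (Q? i) ⟧)))

      ∣∣-disjoint : ∣ P? ∣ ℕ.+ ∣ Q? ∣ ℕ.≤ ∣ R? ∣
      ∣∣-disjoint = ℕ.≤-trans (ℕ.≤-reflexive lhs)
        (ℕ.≤-trans (∑-mono (allFin n) pointwise) (ℕ.≤-reflexive (≡.sym (length-filter′ R? (allFin n)))))
        where
        pointwise : ∀ i → ⟦ does (P? i) ⟧ ℕ.+ ⟦ does (Q? i) ⟧ ℕ.≤ ⟦ does (R? i) ⟧
        pointwise i with P? i | Q? i | R? i
        ... | yes Pi | yes Qi | _      = contradiction Qi (P⇒¬Q i Pi)
        ... | yes Pi | no _   | yes _  = ℕ.≤-refl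
        ... | yes Pi | no _   | no ¬Ri = contradiction (P⇒R i Pi) ¬Ri
        ... | no _   | yes Qi | yes _  = ℕ.≤-refl
        ... | no _   | yes Qi | no ¬Ri = contradiction (Q⇒R i Qi) ¬Ri
        ... | no _   | no _   | _      = ℕ.z≤n

      ∣∣-partition : (∀ i → R i → P i ⊎ Q i) → ∣ P? ∣ ℕ.+ ∣ Q? ∣ ≡ ∣ R? ∣
      ∣∣-partition R⇒P⊎Q = ≡.trans lhs
        (≡.trans (∑-cong (allFin n) pointwise) (≡.sym (length-filter′ R? (allFin n))))
        where
        pointwise : ∀ i → ⟦ does (P? i) ⟧ ℕ.+ ⟦ does (Q? i) ⟧ ≡ ⟦ does (R? i) ⟧
        pointwise i with P? i | Q? i | R? i
        ... | yes Pi | yes Qi | _      = contradiction Qi (P⇒¬Q i Pi)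
        ... | yes Pi | no _   | yes _  = ≡.refl
        ... | yes Pi | no _   | no ¬Ri = contradiction (P⇒R i Pi) ¬Ri
        ... | no _   | yes Qi | yes _  = ≡.refl
        ... | no _   | yes Qi | no ¬Ri = contradiction (Q⇒R i Qi) ¬Ri
        ... | no ¬Pi | no ¬Qi | yes Ri = contradiction (R⇒P⊎Q i Ri) Sum.[ ¬Pi , ¬Qi ]
        ... | no _   | no _   | no _   = ≡.refl

  ∣≟∣ : ∀ (i : Fin n) → ∣ Fin._≟ i ∣ ≡ 1
  ∣≟∣ {n} i = ≡.trans (length-filter′ (Fin._≟ i) (allFin n)) (∑-δ-allFinʳ n i)

  ∣∣-mono-< : ∀ {P : Pred (Fin n) ℓ} {Q : Pred (Fin n) ℓ′} (P? : Decidable P) (Q? : Decidable Q) →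
              (∀ i → P i → Q i) → ∀ i → Q i → ¬ P i → ∣ P? ∣ ℕ.< ∣ Q? ∣
  ∣∣-mono-< P? Q? P⇒Q i Qi ¬Pi = ℕ.≤-trans
    (ℕ.≤-reflexive (≡.trans (ℕ.+-comm 1 _) (≡.cong (∣ P? ∣ ℕ.+_) (≡.sym (∣≟∣ i)))))
    (∣∣-disjoint P? (Fin._≟ i) Q? P⇒Q (λ { _ ≡.refl → Qi }) (λ { _ Pi ≡.refl → ¬Pi Pi }))

  ∣∣-suc : ∀ {P : Pred (Fin n) ℓ} {Q : Pred (Fin n) ℓ′} (P? : Decidable P) (Q? : Decidable Q) →
           (∀ i → P i → Q i) → ∀ i → Q i → ¬ P i → (∀ j → Q j → P j ⊎ j ≡ i) →
           ∣ Q? ∣ ≡ suc ∣ P? ∣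
  ∣∣-suc P? Q? P⇒Q i Qi ¬Pi Q⇒ = ≡.trans
    (≡.sym (∣∣-partition P? (Fin._≟ i) Q? P⇒Q (λ { _ ≡.refl → Qi }) (λ { _ Pi ≡.refl → ¬Pi Pi }) Q⇒))
    (≡.trans (≡.cong (∣ P? ∣ ℕ.+_) (∣≟∣ i)) (ℕ.+-comm _ 1))

  at-< : ∀ (σ : Permutation′ m) {l} (l<m : l ℕ.< m) → σ at l ≡ toℕ (σ ⟨$⟩ʳ fromℕ< l<m)
  at-< {m} σ {l} l<m with l ℕ.<? m
  ... | yes _  = ≡.refl
  ... | no l≮m = contradiction l<m l≮m

  at-bounded : ∀ (σ : Permutation′ m) {l} → l ℕ.< m → σ at l ℕ.< m
  at-bounded σ l<m = ≡.subst (ℕ._< _) (≡.sym (at-< σ l<m)) (Fin.toℕ<n _)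

  at-injective : ∀ (σ : Permutation′ m) {l l′} → l ℕ.< m → l′ ℕ.< m →
                 σ at l ≡ σ at l′ → l ≡ l′
  at-injective σ {l} {l′} l<m l′<m eq = Fin.fromℕ<-injective _ _ l<m l′<m
    (permutation-injective σ (Fin.toℕ-injective
      (≡.trans (≡.sym (at-< σ l<m)) (≡.trans eq (at-< σ l′<m)))))

  -- `written` with the statistics of the word as separate arguments, and any m
  -- for zeros w, so that no transport is needed between words with equal statistics.
  place : ℤ → Permutation′ m → ℕ → ℕ → ℕ → ℕ
  place +[1+ _ ] σ s l r = s ℕ.+ l
  place -[1+ _ ] σ s l r = s ℕ.+ r
  place +0       σ s l r = s ℕ.+ σ at l

  place-cong : ∀ x {σ σ′ : Permutation′ m} s l r → (x ≡ 0ℤ → σ at l ≡ σ′ at l) →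
               place x σ s l r ≡ place x σ′ s l r
  place-cong +[1+ _ ] s l r eq = ≡.refl
  place-cong -[1+ _ ] s l r eq = ≡.refl
  place-cong +0       s l r eq = ≡.cong (s ℕ.+_) (eq ≡.refl)

  place-≥ : ∀ x {σ : Permutation′ m} s l r → s ℕ.≤ place x σ s l r
  place-≥ +[1+ _ ] s l r = ℕ.m≤m+n s _
  place-≥ -[1+ _ ] s l r = ℕ.m≤m+n s _
  place-≥ +0       s l r = ℕ.m≤m+n s _

  place-< : ∀ x {σ : Permutation′ m} s {l r e} → l ℕ.< e → r ℕ.< e →
            (x ≡ 0ℤ → σ at l ℕ.< e) → place x σ s l r ℕ.< s ℕ.+ e
  place-< +[1+ _ ] s l< r< at< = ℕ.+-monoʳ-< s l<
  place-< -[1+ _ ] s l< r< at< = ℕ.+-monoʳ-< s r<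
  place-< +0       s l< r< at< = ℕ.+-monoʳ-< s (at< ≡.refl)

  place-≢ : ∀ x {σ : Permutation′ m} s {l l′ r r′} → l ≢ l′ → r ≢ r′ →
            (x ≡ 0ℤ → σ at l ≢ σ at l′) → place x σ s l r ≢ place x σ s l′ r′
  place-≢ +[1+ _ ] s l≢ r≢ at≢ = l≢ ∘ ℕ.+-cancelˡ-≡ s _ _
  place-≢ -[1+ _ ] s l≢ r≢ at≢ = r≢ ∘ ℕ.+-cancelˡ-≡ s _ _
  place-≢ +0       s l≢ r≢ at≢ = at≢ ≡.refl ∘ ℕ.+-cancelˡ-≡ s _ _

  -- The arguments are the statistics of two neighbouring occurrences of `x`: passing from the left
  -- one to the right one moves one unit from `equalRight` to `equalLeft`. An increasing block puts
  -- the right one just after the left one, a decreasing block just before it.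
  place-adjacent : ∀ x {σ : Permutation′ m} s l r → x ≢ 0ℤ →
    place x σ s (suc l) r ≡ suc (place x σ s l (suc r)) ⊎
    place x σ s l (suc r) ≡ suc (place x σ s (suc l) r)
  place-adjacent +[1+ _ ] s l r x≢0 = inj₁ (ℕ.+-suc s l)
  place-adjacent -[1+ _ ] s l r x≢0 = inj₂ (ℕ.+-suc s r)
  place-adjacent +0       s l r x≢0 = contradiction ≡.refl x≢0

  placed : Word n → Permutation′ m → Fin n → ℕ
  placed w σ j = place (w j) σ (smaller w j) (equalLeft w j) (equalRight w j)

  written≡placed : ∀ (w : Word n) j σ → written w j σ ≡ placed w σ j
  written≡placed w j σ with w j in eq
  ... | +[1+ _ ] = ≡.cong (λ x → ∣ (λ i → w i ℤ.<? x) ∣ ℕ.+ ∣ (λ i → (w i ℤ.≟ x) ×-dec (i Fin.<? j)) ∣) eq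
  ... | -[1+ _ ] = ≡.cong (λ x → ∣ (λ i → w i ℤ.<? x) ∣ ℕ.+ ∣ (λ i → (w i ℤ.≟ x) ×-dec (j Fin.<? i)) ∣) eq
  ... | +0       = ≡.cong (λ x → ∣ (λ i → w i ℤ.<? x) ∣ ℕ.+ σ at ∣ (λ i → (w i ℤ.≟ x) ×-dec (i Fin.<? j)) ∣) eq

  Produces? : ∀ (w : Word n) (σ : Permutation′ m) (π : Permutation′ n) →
              Dec (∀ j → toℕ (π ⟨$⟩ʳ j) ≡ placed w σ j)
  Produces? w σ π = Fin.all? λ j → toℕ (π ⟨$⟩ʳ j) ℕ.≟ placed w σ j

  orders-∑ : ∀ (w : Word n) π →
             orders w π ≡ ∑ (allPerms (zeros w)) (λ σ → ⟦ does (Produces? w σ π) ⟧)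
  orders-∑ w π = ≡.trans (length-filter′ _ (allPerms (zeros w)))
    (∑-cong (allPerms (zeros w)) λ σ → ⟦⟧-⇔ (Fin.all? λ j → toℕ (π ⟨$⟩ʳ j) ℕ.≟ written w j σ)
      (Produces? w σ π)
      (λ eq j → ≡.trans (eq j) (written≡placed w j σ))
      (λ eq j → ≡.trans (eq j) (≡.sym (written≡placed w j σ))))

  module _ (w : Word n) where

    equal : ℤ → ℕ
    equal x = ∣ (λ i → w i ℤ.≟ x) ∣

    equalLeft<equal : ∀ j → equalLeft w j ℕ.< equal (w j)
    equalLeft<equal j = ∣∣-mono-< _ _ (λ _ → proj₁) j ≡.refl (ℕ.<-irrefl ≡.refl ∘ proj₂)

    equalRight<equal : ∀ j → equalRight w j ℕ.< equal (w j)
    equalRight<equal j = ∣∣-mono-< _ _ (λ _ → proj₁) j ≡.refl (ℕ.<-irrefl ≡.refl ∘ proj₂)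

    smaller-cong : ∀ {i j} → w i ≡ w j → smaller w i ≡ smaller w j
    smaller-cong = ≡.cong λ x → ∣ (λ i → w i ℤ.<? x) ∣

    module _ {i j} (wi≡wj : w i ≡ w j) (i<j : i Fin.< j) where

      equalLeft-mono : equalLeft w i ℕ.< equalLeft w j
      equalLeft-mono = ∣∣-mono-< _ _
        (λ k (eq , k<i) → ≡.trans eq wi≡wj , ℕ.<-trans k<i i<j)
        i (wi≡wj , i<j) (ℕ.<-irrefl ≡.refl ∘ proj₂)

      equalRight-mono : equalRight w j ℕ.< equalRight w i
      equalRight-mono = ∣∣-mono-< _ _
        (λ k (eq , j<k) → ≡.trans eq (≡.sym wi≡wj) , ℕ.<-trans i<j j<k)
        j (≡.sym wi≡wj , i<j) (ℕ.<-irrefl ≡.refl ∘ proj₂)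

    module _ {i j} (wi≡wj : w i ≡ w j) (j≡1+i : toℕ j ≡ suc (toℕ i)) where

      private
        i<j : i Fin.< j
        i<j = ℕ.≤-reflexive (≡.sym j≡1+i)

      equalLeft-suc : equalLeft w j ≡ suc (equalLeft w i)
      equalLeft-suc = ∣∣-suc _ _
        (λ k (eq , k<i) → ≡.trans eq wi≡wj , ℕ.<-trans k<i i<j)
        i (wi≡wj , i<j) (ℕ.<-irrefl ≡.refl ∘ proj₂)
        (λ k (eq , k<j) → Sum.map (≡.trans eq (≡.sym wi≡wj) ,_) Fin.toℕ-injective
          (ℕ.m≤n⇒m<n∨m≡n (ℕ.≤-pred (≡.subst (toℕ k ℕ.<_) j≡1+i k<j))))

      equalRight-suc : equalRight w i ≡ suc (equalRight w j)
      equalRight-suc = ∣∣-suc _ _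
        (λ k (eq , j<k) → ≡.trans eq (≡.sym wi≡wj) , ℕ.<-trans i<j j<k)
        j (≡.sym wi≡wj , i<j) (ℕ.<-irrefl ≡.refl ∘ proj₂)
        (λ k (eq , i<k) → Sum.map (≡.trans eq wi≡wj ,_) (Fin.toℕ-injective ∘ ≡.sym)
          (ℕ.m≤n⇒m<n∨m≡n (≡.subst (ℕ._≤ toℕ k) (≡.sym j≡1+i) i<k)))

    smaller+equal≤n : ∀ j → smaller w j ℕ.+ equal (w j) ℕ.≤ n
    smaller+equal≤n j = ℕ.≤-trans
      -- `w i ≡ w i` stands for the predicate that holds at all `n` positions.
      (∣∣-disjoint _ _ {R = λ i → w i ≡ w i} (λ i → w i ℤ.≟ w i) (λ _ _ → ≡.refl) (λ _ _ → ≡.refl)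
        (λ i lt eq → ℤ.<-irrefl eq lt))
      (ℕ.≤-trans (List.length-filter _ (allFin n)) (ℕ.≤-reflexive (List.length-tabulate {n = n} id)))

    smaller+equal≤smaller : ∀ {i j} → w i ℤ.< w j →
                            smaller w i ℕ.+ equal (w i) ℕ.≤ smaller w j
    smaller+equal≤smaller {i} {j} wi<wj = ∣∣-disjoint
      (λ k → w k ℤ.<? w i) (λ k → w k ℤ.≟ w i) (λ k → w k ℤ.<? w j)
      (λ k lt → ℤ.<-trans lt wi<wj) (λ k eq → ≡.subst (ℤ._< w j) (≡.sym eq) wi<wj)
      (λ k lt eq → ℤ.<-irrefl eq lt)

    equalLeft<zeros : ∀ j → w j ≡ 0ℤ → equalLeft w j ℕ.< zeros w
    equalLeft<zeros j wj≡0 = ≡.subst (λ x → equalLeft w j ℕ.< equal x) wj≡0 (equalLeft<equal j)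

    module _ (σ : Permutation′ (zeros w)) where

      placed<smaller+equal : ∀ j → placed w σ j ℕ.< smaller w j ℕ.+ equal (w j)
      placed<smaller+equal j = place-< (w j) (smaller w j) (equalLeft<equal j) (equalRight<equal j)
        λ wj≡0 → ≡.subst (λ x → σ at equalLeft w j ℕ.< equal x) (≡.sym wj≡0)
          (at-bounded σ (equalLeft<zeros j wj≡0))

      placed<n : ∀ j → placed w σ j ℕ.< n
      placed<n j = ℕ.<-≤-trans (placed<smaller+equal j) (smaller+equal≤n j)

      private
        placed-≢-< : ∀ {i j} → w i ℤ.< w j → placed w σ i ≢ placed w σ j
        placed-≢-< {i} {j} wi<wj = ℕ.<⇒≢ (ℕ.<-≤-trans (placed<smaller+equal i)
          (ℕ.≤-trans (smaller+equal≤smaller wi<wj) (place-≥ (w j) (smaller w j) _ _)))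

        placed-≢-≡ : ∀ {i j} → w i ≡ w j → i Fin.< j → placed w σ i ≢ placed w σ j
        placed-≢-≡ {i} {j} wi≡wj i<j eq = place-≢ (w i) (smaller w i)
          (ℕ.<⇒≢ (equalLeft-mono wi≡wj i<j)) (ℕ.>⇒≢ (equalRight-mono wi≡wj i<j))
          (λ wi≡0 → ℕ.<⇒≢ (equalLeft-mono wi≡wj i<j) ∘ at-injective σ
            (equalLeft<zeros i wi≡0) (equalLeft<zeros j (≡.trans (≡.sym wi≡wj) wi≡0)))
          (≡.trans eq (≡.cong₂ (λ x s → place x σ s (equalLeft w j) (equalRight w j))
            (≡.sym wi≡wj) (≡.sym (smaller-cong wi≡wj))))

      -- Different letters write into disjoint intervals, each starting at `smaller` and of length
      -- `equal`. Within one interval the offsets differ: they are ranks from the left, ranks from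
      -- the right, or images of ranks under `σ`.
      placed-injective : Injective _≡_ _≡_ (placed w σ)
      placed-injective {i} {j} eq with ℤ.<-cmp (w i) (w j)
      ... | tri< wi<wj _ _ = contradiction eq (placed-≢-< wi<wj)
      ... | tri> _ _ wj<wi = contradiction (≡.sym eq) (placed-≢-< wj<wi)
      ... | tri≈ _ wi≡wj _ with Fin.<-cmp i j
      ...   | tri< i<j _ _ = contradiction eq (placed-≢-≡ wi≡wj i<j)
      ...   | tri≈ _ i≡j _ = i≡j
      ...   | tri> _ _ j<i = contradiction (≡.sym eq) (placed-≢-≡ (≡.sym wi≡wj) j<i)

  -- Double counting: each order `σ` of the zero block produces exactly one permutation, since
  -- `placed w σ` is injective with values below `n`. This makes `givenWord` a probability.
  ∑-orders : ∀ (w : Word n) → ∑ (allPerms n) (orders w) ≡ zeros w !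
  ∑-orders {n} w = begin
    ∑ (allPerms n) (orders w)
      ≡⟨ ∑-cong (allPerms n) (orders-∑ w) ⟩
    ∑ (allPerms n) (λ π → ∑ (allPerms (zeros w)) λ σ → ⟦ does (Produces? w σ π) ⟧)
      ≡⟨ ∑-swap (allPerms n) (allPerms (zeros w)) (λ π σ → ⟦ does (Produces? w σ π) ⟧) ⟩
    ∑ (allPerms (zeros w)) (λ σ → ∑ (allPerms n) λ π → ⟦ does (Produces? w σ π) ⟧)
      ≡⟨ ∑-cong (allPerms (zeros w)) one ⟩
    ∑ (allPerms (zeros w)) (λ _ → 1)
      ≡⟨ ∑-one (allPerms (zeros w)) ⟩
    length (allPerms (zeros w))
      ≡⟨ length-allPerms (zeros w) ⟩
    zeros w ! ∎
    where
    open ≡.≡-Reasoning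
    ∑-one : ∀ (xs : List A) → ∑ xs (λ _ → 1) ≡ length xs
    ∑-one []       = ≡.refl
    ∑-one (x ∷ xs) = ≡.cong suc (∑-one xs)
    one : ∀ σ → ∑ (allPerms n) (λ π → ⟦ does (Produces? w σ π) ⟧) ≡ 1
    one σ = ≡.trans
      (∑-cong (allPerms n) λ π → ⟦⟧-⇔ (Produces? w σ π) ((π ⟨$⟩ʳ_) ≗? f)
        (λ eq j → Fin.toℕ-injective (≡.trans (eq j) (≡.sym (Fin.toℕ-fromℕ< (placed<n w σ j)))))
        (λ eq j → ≡.trans (≡.cong toℕ (eq j)) (Fin.toℕ-fromℕ< (placed<n w σ j))))
      (∑-δ-allPerms n f λ {i} {j} eq → placed-injective w σ
        (Fin.fromℕ<-injective _ _ (placed<n w σ i) (placed<n w σ j) eq))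
      where
      f : Fin n → Fin n
      f j = fromℕ< (placed<n w σ j)

  zeros-permute : ∀ (s : Permutation′ n) {w w′ : Word n} → (∀ j → w′ j ≡ w (s ⟨$⟩ʳ j)) →
                  zeros w′ ≡ zeros w
  zeros-permute s w′≡w∘s =
    ∣∣-permute _ _ s (λ i → ≡.trans (≡.sym (w′≡w∘s i))) (λ i → ≡.trans (w′≡w∘s i))

  -- The statistics of a word depend on its order only through the relative
  -- order of equal letters.
  module _ (s : Permutation′ n) {w w′ : Word n} (w′≡w∘s : ∀ j → w′ j ≡ w (s ⟨$⟩ʳ j))
           (mono : ∀ i j → w′ i ≡ w′ j → i Fin.< j → s ⟨$⟩ʳ i Fin.< s ⟨$⟩ʳ j) where

    private
      to-≡ : ∀ {i j} → w′ i ≡ w′ j → w (s ⟨$⟩ʳ i) ≡ w (s ⟨$⟩ʳ j)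
      to-≡ eq = ≡.trans (≡.sym (w′≡w∘s _)) (≡.trans eq (w′≡w∘s _))

      from-≡ : ∀ {i j} → w (s ⟨$⟩ʳ i) ≡ w (s ⟨$⟩ʳ j) → w′ i ≡ w′ j
      from-≡ eq = ≡.trans (w′≡w∘s _) (≡.trans eq (≡.sym (w′≡w∘s _)))

      mono⁻¹ : ∀ i j → w′ i ≡ w′ j → s ⟨$⟩ʳ i Fin.< s ⟨$⟩ʳ j → i Fin.< j
      mono⁻¹ i j eq si<sj with Fin.<-cmp i j
      ... | tri< i<j _ _      = i<j
      ... | tri≈ _ ≡.refl _   = contradiction si<sj (ℕ.<-irrefl ≡.refl)
      ... | tri> _ _ j<i      = contradiction (mono j i (≡.sym eq) j<i) (ℕ.<-asym si<sj)

      smaller-≡ : ∀ j → smaller w′ j ≡ smaller w (s ⟨$⟩ʳ j)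
      smaller-≡ j = ∣∣-permute _ _ s
        (λ i → ≡.subst₂ ℤ._<_ (w′≡w∘s i) (w′≡w∘s j))
        (λ i → ≡.subst₂ ℤ._<_ (≡.sym (w′≡w∘s i)) (≡.sym (w′≡w∘s j)))

      equalLeft-≡ : ∀ j → equalLeft w′ j ≡ equalLeft w (s ⟨$⟩ʳ j)
      equalLeft-≡ j = ∣∣-permute _ _ s
        (λ i (eq , i<j) → to-≡ eq , mono i j eq i<j)
        (λ i (eq , i<j) → from-≡ eq , mono⁻¹ i j (from-≡ eq) i<j)

      equalRight-≡ : ∀ j → equalRight w′ j ≡ equalRight w (s ⟨$⟩ʳ j)
      equalRight-≡ j = ∣∣-permute _ _ s
        (λ i (eq , j<i) → to-≡ eq , mono j i (≡.sym eq) j<i)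
        (λ i (eq , j<i) → from-≡ eq , mono⁻¹ j i (≡.sym (from-≡ eq)) j<i)

      placed-≡ : ∀ (σ : Permutation′ m) j → placed w′ σ j ≡ placed w σ (s ⟨$⟩ʳ j)
      placed-≡ σ j rewrite smaller-≡ j | equalLeft-≡ j | equalRight-≡ j =
        ≡.cong (λ x → place x σ _ _ _) (w′≡w∘s j)

    orders-relabel : ∀ {π π′} → (∀ j → π′ ⟨$⟩ʳ j ≡ π ⟨$⟩ʳ (s ⟨$⟩ʳ j)) →
                     orders w′ π′ ≡ orders w π
    orders-relabel {π} {π′} π′≡π∘s = begin
      orders w′ π′
        ≡⟨ orders-∑ w′ π′ ⟩
      ∑ (allPerms (zeros w′)) (λ σ → ⟦ does (Produces? w′ σ π′) ⟧)
        ≡⟨ ≡.cong (λ m → ∑ (allPerms m) (λ σ → ⟦ does (Produces? w′ σ π′) ⟧)) (zeros-permute s w′≡w∘s) ⟩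
      ∑ (allPerms (zeros w)) (λ σ → ⟦ does (Produces? w′ σ π′) ⟧)
        ≡⟨ ∑-cong (allPerms (zeros w)) (λ σ → ⟦⟧-⇔ (Produces? w′ σ π′) (Produces? w σ π)
             (λ eq j → ≡.subst (λ k → toℕ (π ⟨$⟩ʳ k) ≡ placed w σ k) (Perm.inverseʳ s)
               (≡.trans (≡.cong toℕ (≡.sym (π′≡π∘s (s ⟨$⟩ˡ j))))
                 (≡.trans (eq (s ⟨$⟩ˡ j)) (placed-≡ σ (s ⟨$⟩ˡ j)))))
             (λ eq j → ≡.trans (≡.cong toℕ (π′≡π∘s j))
               (≡.trans (eq (s ⟨$⟩ʳ j)) (≡.sym (placed-≡ σ j))))) ⟩
      ∑ (allPerms (zeros w)) (λ σ → ⟦ does (Produces? w σ π) ⟧)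
        ≡⟨ orders-∑ w π ⟨
      orders w π ∎
      where open ≡.≡-Reasoning

  -- Symmetric, because the block of a negative letter reverses its cards: neighbours may leave a
  -- step in the opposite order.
  Adjacent : Fin n → Fin n → Set
  Adjacent i j = toℕ j ≡ suc (toℕ i) ⊎ toℕ i ≡ suc (toℕ j)

  adjacent-< : ∀ {i j k : Fin n} → Adjacent i j → k ≢ j → i Fin.< k → j Fin.< k
  adjacent-< {k = k} (inj₁ j≡1+i) k≢j i<k = ℕ.≤∧≢⇒<
    (≡.subst (ℕ._≤ toℕ k) (≡.sym j≡1+i) i<k) (k≢j ∘ ≡.sym ∘ Fin.toℕ-injective)
  adjacent-< (inj₂ i≡1+j) k≢j i<k = ℕ.<-trans (ℕ.≤-reflexive (≡.sym i≡1+j)) i<k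

  adjacent-> : ∀ {i j k : Fin n} → Adjacent i j → k ≢ j → k Fin.< i → k Fin.< j
  adjacent-> (inj₁ j≡1+i) k≢j k<i = ℕ.<-trans k<i (ℕ.≤-reflexive (≡.sym j≡1+i))
  adjacent-> {k = k} (inj₂ i≡1+j) k≢j k<i = ℕ.≤∧≢⇒<
    (ℕ.≤-pred (≡.subst (toℕ k ℕ.<_) i≡1+j k<i)) (k≢j ∘ Fin.toℕ-injective)

  -- No position lies strictly between neighbours, so exchanging them does not change how a third
  -- position compares with either.
  transpose-mono : ∀ {i j : Fin n} → Adjacent i j → ∀ k l → ¬ (k ≡ i × l ≡ j) → ¬ (k ≡ j × l ≡ i) →
                   k Fin.< l → transpose i j ⟨$⟩ʳ k Fin.< transpose i j ⟨$⟩ʳ l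
  transpose-mono {i = i} {j} adj k l ¬ij ¬ji k<l
    with transpose i j ⟨$⟩ʳ k | view i j k | transpose i j ⟨$⟩ʳ l | view i j l
  ... | _ | atˡ           | _ | atˡ           = contradiction k<l (ℕ.<-irrefl ≡.refl)
  ... | _ | atˡ           | _ | atʳ           = contradiction (≡.refl , ≡.refl) ¬ij
  ... | _ | atˡ           | _ | other l≢i l≢j = adjacent-< adj l≢j k<l
  ... | _ | atʳ           | _ | atˡ           = contradiction (≡.refl , ≡.refl) ¬ji
  ... | _ | atʳ           | _ | atʳ           = contradiction k<l (ℕ.<-irrefl ≡.refl)
  ... | _ | atʳ           | _ | other l≢i l≢j = adjacent-< (Sum.swap adj) l≢i k<l
  ... | _ | other k≢i k≢j | _ | atˡ           = adjacent-> adj k≢j k<l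
  ... | _ | other k≢i k≢j | _ | atʳ           = adjacent-> (Sum.swap adj) k≢i k<l
  ... | _ | other k≢i k≢j | _ | other l≢i l≢j = k<l

  orders-cong : ∀ {w w′ : Word n} {π π′} → (∀ j → w′ j ≡ w j) →
                (∀ j → π′ ⟨$⟩ʳ j ≡ π ⟨$⟩ʳ j) → orders w′ π′ ≡ orders w π
  orders-cong {w = w} {w′} {π} {π′} w≡ π≡ = orders-relabel Perm.id {w} {w′} w≡ (λ _ _ _ → id) {π} {π′} π≡

  -- The pairs that a step fails to separate. Two zeros are excluded: their block is ordered
  -- uniformly, so it already has the symmetry under exchange that is wanted.
  clash : Word n → Fin n → Fin n → Bool
  clash w i j = does (w i ℤ.≟ w j) ∧ not (does (w i ℤ.≟ 0ℤ))

  clash-true : ∀ (w : Word n) i j → clash w i j ≡ true → w i ≡ w j × w i ≢ 0ℤ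
  clash-true w i j eq with w i ℤ.≟ w j | w i ℤ.≟ 0ℤ
  ... | yes wi≡wj | no wi≢0 = wi≡wj , wi≢0

  clash-false : ∀ (w : Word n) i j → clash w i j ≡ false → w i ≢ w j ⊎ (w i ≡ 0ℤ × w j ≡ 0ℤ)
  clash-false w i j eq with w i ℤ.≟ w j | w i ℤ.≟ 0ℤ
  ... | no wi≢wj  | _        = inj₁ wi≢wj
  ... | yes wi≡wj | yes wi≡0 = inj₂ (wi≡0 , ≡.trans (≡.sym wi≡wj) wi≡0)

  clash-cong : ∀ (w w′ : Word n) i j i′ j′ → w i ≡ w′ i′ → w j ≡ w′ j′ → clash w i j ≡ clash w′ i′ j′
  clash-cong w w′ i j i′ j′ eqi eqj =
    ≡.cong₂ (λ x y → does (x ℤ.≟ y) ∧ not (does (x ℤ.≟ 0ℤ))) eqi eqj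

  transpose-comm : ∀ (i j k : Fin n) → transpose i j ⟨$⟩ʳ k ≡ transpose j i ⟨$⟩ʳ k
  transpose-comm i j k with transpose i j ⟨$⟩ʳ k | view i j k
  ... | _ | atˡ           = ≡.sym (transpose-ʳ j i)
  ... | _ | atʳ           = ≡.sym (transpose-ˡ j i)
  ... | _ | other k≢i k≢j = ≡.sym (transpose-other j i k≢j k≢i)

  -- Two adjacent zeros occupy neighbouring places r and r + 1 of the zero
  -- block; swapping them amounts to composing the order of the block with the
  -- transposition of r and r + 1.
  module _ (w : Word n) {i j : Fin n} (j≡1+i : toℕ j ≡ suc (toℕ i))
           (wi≡0 : w i ≡ 0ℤ) (wj≡0 : w j ≡ 0ℤ) where

    private
      p q : Fin (zeros w)
      p = fromℕ< (equalLeft<zeros w i wi≡0)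
      q = fromℕ< (equalLeft<zeros w j wj≡0)

      t : Permutation′ (zeros w)
      t = transpose p q

      s : Permutation′ n
      s = transpose i j

      equalLeft-≢ : ∀ {k l} → w k ≡ w l → k ≢ l → equalLeft w k ≢ equalLeft w l
      equalLeft-≢ {k} {l} wk≡wl k≢l with Fin.<-cmp k l
      ... | tri< k<l _ _ = ℕ.<⇒≢ (equalLeft-mono w wk≡wl k<l)
      ... | tri≈ _ k≡l _ = contradiction k≡l k≢l
      ... | tri> _ _ l<k = ℕ.>⇒≢ (equalLeft-mono w (≡.sym wk≡wl) l<k)

      module _ {σ σ′ : Permutation′ (zeros w)}
               (σ′≡σ∘t : ∀ r → σ′ ⟨$⟩ʳ r ≡ σ ⟨$⟩ʳ (t ⟨$⟩ʳ r)) where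

        at-swap : ∀ {k l} (wk≡0 : w k ≡ 0ℤ) (wl≡0 : w l ≡ 0ℤ) →
                  t ⟨$⟩ʳ fromℕ< (equalLeft<zeros w k wk≡0) ≡ fromℕ< (equalLeft<zeros w l wl≡0) →
                  σ′ at equalLeft w k ≡ σ at equalLeft w l
        at-swap wk≡0 wl≡0 eq = ≡.trans (at-< σ′ (equalLeft<zeros w _ wk≡0)) (≡.trans
          (≡.cong toℕ (≡.trans (σ′≡σ∘t _) (≡.cong (σ ⟨$⟩ʳ_) eq)))
          (≡.sym (at-< σ (equalLeft<zeros w _ wl≡0))))

        placed-zeros : ∀ {k l} (wk≡0 : w k ≡ 0ℤ) (wl≡0 : w l ≡ 0ℤ) →
                       t ⟨$⟩ʳ fromℕ< (equalLeft<zeros w k wk≡0) ≡ fromℕ< (equalLeft<zeros w l wl≡0) →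
                       placed w σ′ k ≡ placed w σ l
        placed-zeros {k} {l} wk≡0 wl≡0 eq = begin
          place (w k) σ′ (smaller w k) (equalLeft w k) (equalRight w k)
            ≡⟨ ≡.cong (λ x → place x σ′ (smaller w k) (equalLeft w k) (equalRight w k)) wk≡0 ⟩
          smaller w k ℕ.+ σ′ at equalLeft w k
            ≡⟨ ≡.cong₂ ℕ._+_ (smaller-cong w (≡.trans wk≡0 (≡.sym wl≡0))) (at-swap wk≡0 wl≡0 eq) ⟩
          smaller w l ℕ.+ σ at equalLeft w l
            ≡⟨ ≡.cong (λ x → place x σ (smaller w l) (equalLeft w l) (equalRight w l)) wl≡0 ⟨
          place (w l) σ (smaller w l) (equalLeft w l) (equalRight w l) ∎
          where open ≡.≡-Reasoning

        placed-swap : ∀ k → placed w σ′ k ≡ placed w σ (s ⟨$⟩ʳ k)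
        placed-swap k with s ⟨$⟩ʳ k | view i j k
        ... | _ | atˡ           = placed-zeros wi≡0 wj≡0 (transpose-ˡ p q)
        ... | _ | atʳ           = placed-zeros wj≡0 wi≡0 (transpose-ʳ p q)
        -- A third card depends on the order of the zero block only if its letter is 0, and then its
        -- place there is neither `p` nor `q`.
        ... | _ | other k≢i k≢j = place-cong (w k) (smaller w k) _ _ λ wk≡0 →
          at-swap wk≡0 wk≡0 (transpose-other p q
            (equalLeft-≢ (≡.trans wk≡0 (≡.sym wi≡0)) k≢i ∘ Fin.fromℕ<-injective _ _ _ _)
            (equalLeft-≢ (≡.trans wk≡0 (≡.sym wj≡0)) k≢j ∘ Fin.fromℕ<-injective _ _ _ _))

    orders-swap-zeros : ∀ {π π′} → (∀ k → π′ ⟨$⟩ʳ k ≡ π ⟨$⟩ʳ (s ⟨$⟩ʳ k)) →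
                        orders w π′ ≡ orders w π
    orders-swap-zeros {π} {π′} π′≡π∘s = begin
      orders w π′
        ≡⟨ orders-∑ w π′ ⟩
      ∑ (allPerms (zeros w)) (λ σ′ → ⟦ does (Produces? w σ′ π′) ⟧)
        ≡⟨ ∑-precompose t (λ σ σ′ eq → ⟦⟧-⇔ (Produces? w σ π) (Produces? w σ′ π′)
             (λ produces k → ≡.trans (≡.cong toℕ (π′≡π∘s k))
               (≡.trans (produces (s ⟨$⟩ʳ k)) (≡.sym (placed-swap eq k))))
             (λ produces k → begin
               toℕ (π ⟨$⟩ʳ k)                         ≡⟨ ≡.cong (toℕ ∘ (π ⟨$⟩ʳ_)) (transpose-involutive i j k) ⟨
               toℕ (π ⟨$⟩ʳ (s ⟨$⟩ʳ (s ⟨$⟩ʳ k)))       ≡⟨ ≡.cong toℕ (π′≡π∘s (s ⟨$⟩ʳ k)) ⟨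
               toℕ (π′ ⟨$⟩ʳ (s ⟨$⟩ʳ k))               ≡⟨ produces (s ⟨$⟩ʳ k) ⟩
               placed w σ′ (s ⟨$⟩ʳ k)                 ≡⟨ placed-swap eq (s ⟨$⟩ʳ k) ⟩
               placed w σ (s ⟨$⟩ʳ (s ⟨$⟩ʳ k))         ≡⟨ ≡.cong (placed w σ) (transpose-involutive i j k) ⟩
               placed w σ k ∎)) ⟨
      ∑ (allPerms (zeros w)) (λ σ → ⟦ does (Produces? w σ π) ⟧)
        ≡⟨ orders-∑ w π ⟨
      orders w π ∎
      where open ≡.≡-Reasoning

  -- If the letters of `i` and `j` differ, the exchange keeps equal letters in their order, and
  -- `orders-relabel` applies. If both are 0, the word stays the same and the exchange is absorbed
  -- into the order of the zero block.
  orders-swap : ∀ (w w′ : Word n) {i j} π π′ → Adjacent i j → clash w i j ≡ false →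
                (∀ k → w′ k ≡ w (transpose i j ⟨$⟩ʳ k)) →
                (∀ k → π′ ⟨$⟩ʳ k ≡ π ⟨$⟩ʳ (transpose i j ⟨$⟩ʳ k)) →
                orders w′ π′ ≡ orders w π
  orders-swap w w′ {i} {j} π π′ adj no-clash w′≡w∘s π′≡π∘s with clash-false w i j no-clash
  ... | inj₁ wi≢wj = orders-relabel (transpose i j) {w} {w′} w′≡w∘s
    (λ k l eq → transpose-mono adj k l
      (λ { (≡.refl , ≡.refl) → wi≢wj (≡.sym (≡.subst₂ (λ k l → w k ≡ w l)
        (transpose-ˡ k l) (transpose-ʳ k l)
        (≡.trans (≡.sym (w′≡w∘s k)) (≡.trans eq (w′≡w∘s l))))) })
      (λ { (≡.refl , ≡.refl) → wi≢wj (≡.subst₂ (λ k l → w k ≡ w l)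
        (transpose-ʳ l k) (transpose-ˡ l k)
        (≡.trans (≡.sym (w′≡w∘s k)) (≡.trans eq (w′≡w∘s l)))) }))
    {π} {π′} π′≡π∘s
  ... | inj₂ (wi≡0 , wj≡0) = ≡.trans (orders-cong {w = w} {w′} {π′} {π′} w′≡w (λ _ → ≡.refl)) (zeros-case adj)
    where
    w′≡w : ∀ k → w′ k ≡ w k
    w′≡w k = ≡.trans (w′≡w∘s k) (swapped k)
      where
      swapped : ∀ k → w (transpose i j ⟨$⟩ʳ k) ≡ w k
      swapped k with transpose i j ⟨$⟩ʳ k | view i j k
      ... | _ | atˡ       = ≡.trans wj≡0 (≡.sym wi≡0)
      ... | _ | atʳ       = ≡.trans wi≡0 (≡.sym wj≡0)
      ... | _ | other _ _ = ≡.refl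
    zeros-case : Adjacent i j → orders w π′ ≡ orders w π
    zeros-case (inj₁ j≡1+i) = orders-swap-zeros w j≡1+i wi≡0 wj≡0 {π} {π′} π′≡π∘s
    zeros-case (inj₂ i≡1+j) = orders-swap-zeros w i≡1+j wj≡0 wi≡0 {π} {π′}
      λ k → ≡.trans (π′≡π∘s k) (≡.cong (π ⟨$⟩ʳ_) (transpose-comm i j k))

  -- Neighbours with the same nonzero letter receive consecutive integers whatever the order of the
  -- zero block, so none of these orders produces `π`.
  orders-clash : ∀ (w : Word n) {i j} π → Adjacent i j → clash w i j ≡ true →
                 ¬ Adjacent (π ⟨$⟩ʳ i) (π ⟨$⟩ʳ j) → orders w π ≡ 0
  orders-clash w {i} {j} π adj eq ¬adj with clash-true w i j eq
  ... | wi≡wj , wi≢0 = ≡.trans (orders-∑ w π) (≡.trans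
    (∑-cong (allPerms (zeros w)) λ σ → ⟦⟧-cong (dec-false (Produces? w σ π) λ produces →
      ¬adj (Sum.map (lift σ produces) (lift σ produces) (placed-adjacent σ adj))))
    (∑-zero (allPerms (zeros w))))
    where
    lift : ∀ (σ : Permutation′ m) {k l} → (∀ k → toℕ (π ⟨$⟩ʳ k) ≡ placed w σ k) →
           placed w σ l ≡ suc (placed w σ k) → toℕ (π ⟨$⟩ʳ l) ≡ suc (toℕ (π ⟨$⟩ʳ k))
    lift σ produces eq = ≡.trans (produces _) (≡.trans eq (≡.cong suc (≡.sym (produces _))))

    step : ∀ (σ : Permutation′ m) {k l} → toℕ l ≡ suc (toℕ k) → w k ≡ w l → w k ≢ 0ℤ →
           placed w σ l ≡ suc (placed w σ k) ⊎ placed w σ k ≡ suc (placed w σ l)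
    step σ {k} {l} l≡1+k wk≡wl wk≢0 = ≡.subst₂ (λ x y → x ≡ suc y ⊎ y ≡ suc x)
      (≡.trans
        (≡.cong (λ a → place (w k) σ (smaller w k) a (equalRight w l)) (≡.sym (equalLeft-suc w wk≡wl l≡1+k)))
        (≡.cong₂ (λ x s → place x σ s (equalLeft w l) (equalRight w l)) wk≡wl (smaller-cong w wk≡wl)))
      (≡.cong (place (w k) σ (smaller w k) (equalLeft w k)) (≡.sym (equalRight-suc w wk≡wl l≡1+k)))
      (place-adjacent (w k) (smaller w k) (equalLeft w k) (equalRight w l) wk≢0)

    placed-adjacent : ∀ (σ : Permutation′ m) → Adjacent i j →
      placed w σ j ≡ suc (placed w σ i) ⊎ placed w σ i ≡ suc (placed w σ j)
    placed-adjacent σ (inj₁ j≡1+i) = step σ j≡1+i wi≡wj wi≢0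
    placed-adjacent σ (inj₂ i≡1+j) = Sum.swap (step σ i≡1+j (≡.sym wi≡wj) (wi≢0 ∘ ≡.trans wi≡wj))

open Orders

-- Ordered fields

module RealFieldProperties {c ℓ₁ ℓ₂} (R : RealField c ℓ₁ ℓ₂) where
  open RealField R hiding (zero)
  open ListSum (RealField.commutativeSemiring R)
  open Solver (RealField.commutativeSemiring R) using (solve; _:=_; _:+_; _:*_; con)

  ≤-refl : ∀ {x} → x ≤ x
  ≤-refl = <-irrefl refl

  ≤-reflexive : ∀ {x y} → x ≈ y → x ≤ y
  ≤-reflexive x≈y = <-irrefl (sym x≈y)

  ≤-trans : ∀ {x y z} → x ≤ y → y ≤ z → x ≤ z
  ≤-trans x≤y y≤z z<x = Sum.[ y≤z , x≤y ] (<-cotrans z<x _)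

  <⇒≤ : ∀ {x y} → x < y → x ≤ y
  <⇒≤ x<y y<x = <-irrefl refl (<-trans x<y y<x)

  <-≤-trans : ∀ {x y z} → x < y → y ≤ z → x < z
  <-≤-trans x<y y≤z = Sum.[ id , (λ z<y → contradiction z<y y≤z) ] (<-cotrans x<y _)

  ≤-preorder : Preorder c ℓ₁ ℓ₂
  ≤-preorder = record
    { isPreorder = record
      { isEquivalence = isEquivalence ; reflexive = ≤-reflexive ; trans = ≤-trans } }

  open PreorderReasoning ≤-preorder

  [x+y]-y : ∀ x y → x + y - y ≈ x
  [x+y]-y x y = trans (+-assoc x y _) (trans (+-congˡ (-‿inverseʳ y)) (+-identityʳ x))

  [x-y]+y : ∀ x y → x - y + y ≈ x
  [x-y]+y x y = trans (+-assoc x _ y) (trans (+-congˡ (-‿inverseˡ y)) (+-identityʳ x))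

  +-cancelʳ-< : ∀ {x y} z → x + z < y + z → x < y
  +-cancelʳ-< z lt = <-respˡ-≈ ([x+y]-y _ z) (<-respʳ-≈ ([x+y]-y _ z) (+-monoˡ-< (- z) lt))

  +-monoˡ-≤ : ∀ {x y} z → x ≤ y → x + z ≤ y + z
  +-monoˡ-≤ z x≤y = x≤y ∘ +-cancelʳ-< z

  +-mono-≤ : ∀ {x y u v} → x ≤ y → u ≤ v → x + u ≤ y + v
  +-mono-≤ {x} {y} {u} {v} x≤y u≤v = begin
    x + u ≲⟨ +-monoˡ-≤ u x≤y ⟩
    y + u ≈⟨ +-comm y u ⟩
    u + y ≲⟨ +-monoˡ-≤ y u≤v ⟩
    v + y ≈⟨ +-comm v y ⟩
    y + v ∎

  +-cancelʳ-≤ : ∀ {x y} z → x + z ≤ y + z → x ≤ y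
  +-cancelʳ-≤ z le = le ∘ +-monoˡ-< z

  x≤x+y : ∀ {x y} → 0# ≤ y → x ≤ x + y
  x≤x+y 0≤y = ≤-trans (≤-reflexive (sym (+-identityʳ _))) (+-mono-≤ ≤-refl 0≤y)

  +-nonneg : ∀ {x y} → 0# ≤ x → 0# ≤ y → 0# ≤ x + y
  +-nonneg 0≤x 0≤y = ≤-trans 0≤x (x≤x+y 0≤y)

  0<y-x : ∀ {x y} → x < y → 0# < y - x
  0<y-x {x} x<y = <-respˡ-≈ (-‿inverseʳ x) (+-monoˡ-< (- x) x<y)

  0≤y-x : ∀ {x y} → x ≤ y → 0# ≤ y - x
  0≤y-x {x} x≤y = ≤-trans (≤-reflexive (sym (-‿inverseʳ x))) (+-monoˡ-≤ (- x) x≤y)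

  -- The conclusion is a negation, which permits a case distinction on whether each factor is
  -- positive; a factor that is not is zero by tightness.
  *-nonneg : ∀ {x y} → 0# ≤ x → 0# ≤ y → 0# ≤ x * y
  *-nonneg {x} {y} 0≤x 0≤y xy<0 = ¬0<x λ 0<x → ¬0<y 0<x
    where
    ¬0<x : ¬ ¬ 0# < x
    ¬0<x ¬0<x = <-irrefl (trans (*-congʳ (<-tight 0≤x ¬0<x)) (zeroˡ y)) xy<0
    ¬0<y : ¬ 0# < x
    ¬0<y 0<x = ¬¬0<y λ 0<y → <⇒≤ (*-pos 0<x 0<y) xy<0
      where
      ¬¬0<y : ¬ ¬ 0# < y
      ¬¬0<y ¬0<y = <-irrefl (trans (*-congˡ (<-tight 0≤y ¬0<y)) (zeroʳ x)) xy<0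

  *-monoˡ-≤ : ∀ {x y z} → 0# ≤ z → x ≤ y → z * x ≤ z * y
  *-monoˡ-≤ {x} {y} {z} 0≤z x≤y = begin
    z * x               ≲⟨ x≤x+y (*-nonneg 0≤z (0≤y-x x≤y)) ⟩
    z * x + z * (y - x) ≈⟨ distribˡ z x (y - x) ⟨
    z * (x + (y - x))   ≈⟨ *-congˡ (trans (+-comm x _) ([x-y]+y y x)) ⟩
    z * y ∎

  *-monoʳ-≤ : ∀ {x y z} → 0# ≤ z → x ≤ y → x * z ≤ y * z
  *-monoʳ-≤ {x} {y} {z} 0≤z x≤y = begin
    x * z ≈⟨ *-comm x z ⟩
    z * x ≲⟨ *-monoˡ-≤ 0≤z x≤y ⟩
    z * y ≈⟨ *-comm z y ⟩
    y * z ∎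

  *-mono-≤ : ∀ {x y u v} → 0# ≤ u → 0# ≤ y → x ≤ y → u ≤ v → x * u ≤ y * v
  *-mono-≤ 0≤u 0≤y x≤y u≤v = ≤-trans (*-monoʳ-≤ 0≤u x≤y) (*-monoˡ-≤ 0≤y u≤v)

  *-cancelˡ-≤ : ∀ {x y z} → 0# < z → z * x ≤ z * y → x ≤ y
  *-cancelˡ-≤ {x} {y} {z} 0<z zx≤zy y<x = zx≤zy
    (<-respˡ-≈ (+-identityˡ _) (<-respʳ-≈ z[x-y]+zy (+-monoˡ-< (z * y) (*-pos 0<z (0<y-x y<x)))))
    where
    z[x-y]+zy : z * (x - y) + z * y ≈ z * x
    z[x-y]+zy = trans (sym (distribˡ z (x - y) y)) (*-congˡ ([x-y]+y x y))

  0≤1 : 0# ≤ 1#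
  0≤1 = <⇒≤ 0<1

  ^-nonneg : ∀ {x} → 0# ≤ x → ∀ n → 0# ≤ x ^ n
  ^-nonneg 0≤x zero    = 0≤1
  ^-nonneg 0≤x (suc n) = *-nonneg 0≤x (^-nonneg 0≤x n)

  ^-mono-≤ : ∀ {x y} → 0# ≤ x → x ≤ y → ∀ n → x ^ n ≤ y ^ n
  ^-mono-≤ 0≤x x≤y zero    = ≤-refl
  ^-mono-≤ 0≤x x≤y (suc n) = *-mono-≤ (^-nonneg 0≤x n) (≤-trans 0≤x x≤y) x≤y (^-mono-≤ 0≤x x≤y n)

  x^n≤1 : ∀ {x} → 0# ≤ x → x ≤ 1# → ∀ n → x ^ n ≤ 1#
  x^n≤1 0≤x x≤1 zero    = ≤-refl
  x^n≤1 0≤x x≤1 (suc n) = ≤-trans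
    (*-mono-≤ (^-nonneg 0≤x n) 0≤1 x≤1 (x^n≤1 0≤x x≤1 n)) (≤-reflexive (*-identityˡ 1#))

  fromℕ-+ : ∀ m n → fromℕ (m ℕ.+ n) ≈ fromℕ m + fromℕ n
  fromℕ-+ = Mult.×-homo-+ +-monoid 1#

  fromℕ-* : ∀ m n → fromℕ (m ℕ.* n) ≈ fromℕ m * fromℕ n
  fromℕ-* = SemiringMult.×1-homo-* semiring

  fromℕ-nonneg : ∀ n → 0# ≤ fromℕ n
  fromℕ-nonneg zero    = ≤-refl
  fromℕ-nonneg (suc n) = +-nonneg 0≤1 (fromℕ-nonneg n)

  fromℕ-mono-≤ : ∀ {m n} → m ℕ.≤ n → fromℕ m ≤ fromℕ n
  fromℕ-mono-≤ {n = n} ℕ.z≤n = fromℕ-nonneg n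
  fromℕ-mono-≤ (ℕ.s≤s m≤n) = +-mono-≤ ≤-refl (fromℕ-mono-≤ m≤n)

  fromℕ-cancel-≤ : ∀ {m n} → fromℕ m ≤ fromℕ n → m ℕ.≤ n
  fromℕ-cancel-≤ {m} {n} le = ℕ.≮⇒≥ λ n<m → le
    (<-≤-trans (<-respˡ-≈ (+-identityˡ _) (+-monoˡ-< (fromℕ n) 0<1)) (fromℕ-mono-≤ n<m))

  *-recip : ∀ {x} (0<x : 0# < x) → x * recip 0<x ≈ 1#
  *-recip 0<x = proj₂ (proj₂ (inverse 0<x))

  ⟦⟧-nonneg : ∀ b → 0# ≤ ⟦ b ⟧
  ⟦⟧-nonneg true  = 0≤1
  ⟦⟧-nonneg false = ≤-refl

  ∑-mono-≤ : ∀ (xs : List A) {f g} → (∀ x → f x ≤ g x) → ∑ xs f ≤ ∑ xs g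
  ∑-mono-≤ []       f≤g = ≤-refl
  ∑-mono-≤ (x ∷ xs) f≤g = +-mono-≤ (f≤g x) (∑-mono-≤ xs f≤g)

  ∑-nonneg : ∀ (xs : List A) {f} → (∀ x → 0# ≤ f x) → 0# ≤ ∑ xs f
  ∑-nonneg []       0≤f = ≤-refl
  ∑-nonneg (x ∷ xs) 0≤f = +-nonneg (0≤f x) (∑-nonneg xs 0≤f)

  ≤-closed : ∀ {x y} m → (∀ ε → 0# < ε → x ≤ y + fromℕ m * ε) → x ≤ y
  ≤-closed {x} {y} m x≤y+mε y<x = x≤y+mε ε 0<ε (<-≤-trans
    (<-respˡ-≈ (+-identityˡ _) (+-monoˡ-< (y + fromℕ m * ε) 0<ε)) (≤-reflexive eq))
    where
    δ ε : ℝ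
    δ = x - y
    -- With `suc m` in place of `m`, the term `fromℕ m * ε` falls short of the gap `δ` by one `ε`,
    -- which yields the strict inequality.
    ε = δ * 1/ (suc m)
    0<ε : 0# < ε
    0<ε = *-pos (0<y-x y<x) (recip>0 (fromℕ>0 (suc m)))
    eq : ε + (y + fromℕ m * ε) ≈ x
    eq = begin-equality
      ε + (y + fromℕ m * ε)
        ≈⟨ solve 3 (λ e y k → e :+ (y :+ k :* e) := e :* (con 1 :+ k) :+ y) refl ε y (fromℕ m) ⟩
      δ * 1/ (suc m) * fromℕ (suc m) + y
        ≈⟨ +-congʳ (trans (*-assoc δ _ _) (*-congˡ (trans (*-comm _ _) (*-recip (fromℕ>0 (suc m)))))) ⟩
      δ * 1# + y
        ≈⟨ +-congʳ (*-identityʳ δ) ⟩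
      x - y + y
        ≈⟨ [x-y]+y x y ⟩
      x ∎

  -- Bernoulli's inequality for powers of a number just below 1, free of subtraction. It bounds the
  -- mass lost by cutting off the alphabet in all letters of all steps.
  bernoulli-≤1 : ∀ {x ε} → 0# ≤ x → x ≤ 1# → 0# ≤ ε → 1# ≤ x + ε →
                 ∀ m → 1# ≤ x ^ m + fromℕ m * ε
  bernoulli-≤1 {x} {ε} 0≤x x≤1 0≤ε 1≤x+ε zero = x≤x+y (*-nonneg ≤-refl 0≤ε)
  bernoulli-≤1 {x} {ε} 0≤x x≤1 0≤ε 1≤x+ε (suc m) = begin
    1#
      ≲⟨ 1≤x+ε ⟩
    x + ε
      ≈⟨ +-congʳ (*-identityʳ x) ⟨
    x * 1# + ε
      ≲⟨ +-monoˡ-≤ ε (*-monoˡ-≤ 0≤x (bernoulli-≤1 0≤x x≤1 0≤ε 1≤x+ε m)) ⟩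
    x * (x ^ m + fromℕ m * ε) + ε
      ≈⟨ +-congʳ (distribˡ x _ _) ⟩
    x * x ^ m + x * (fromℕ m * ε) + ε
      ≲⟨ +-monoˡ-≤ ε (+-mono-≤ ≤-refl (*-monoʳ-≤ (*-nonneg (fromℕ-nonneg m) 0≤ε) x≤1)) ⟩
    x * x ^ m + 1# * (fromℕ m * ε) + ε
      ≈⟨ +-assoc _ _ _ ⟩
    x * x ^ m + (1# * (fromℕ m * ε) + ε)
      ≈⟨ +-congˡ (trans (+-congʳ (*-identityˡ _))
           (trans (+-comm _ _) (trans (+-congʳ (sym (*-identityˡ ε))) (sym (distribʳ ε 1# _))))) ⟩
    x * x ^ m + (1# + fromℕ m) * ε ∎

  bernoulli : ∀ {ε} → 0# ≤ ε → ∀ m → 1# + fromℕ m * ε ≤ (1# + ε) ^ m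
  bernoulli {ε} 0≤ε zero = ≤-reflexive (trans (+-congˡ (zeroˡ ε)) (+-identityʳ 1#))
  bernoulli {ε} 0≤ε (suc m) = begin
    1# + (1# + fromℕ m) * ε
      ≲⟨ x≤x+y (*-nonneg 0≤ε (*-nonneg (fromℕ-nonneg m) 0≤ε)) ⟩
    1# + (1# + fromℕ m) * ε + ε * (fromℕ m * ε)
      ≈⟨ +-congʳ (+-cong (sym (*-identityˡ 1#)) refl) ⟩
    1# * 1# + (1# + fromℕ m) * ε + ε * (fromℕ m * ε)
      ≈⟨ solve 3 (λ o k e → o :* o :+ (o :+ k) :* e :+ e :* (k :* e)
                        := o :* o :+ o :* e :+ k :* e :+ e :* (k :* e)) refl 1# (fromℕ m) ε ⟩
    1# * 1# + 1# * ε + fromℕ m * ε + ε * (fromℕ m * ε)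
      ≈⟨ +-congʳ (+-cong (+-congˡ (trans (*-comm 1# ε) refl)) (sym (*-identityˡ _))) ⟩
    1# * 1# + ε * 1# + 1# * (fromℕ m * ε) + ε * (fromℕ m * ε)
      ≈⟨ solve 3 (λ o x e → o :* o :+ e :* o :+ o :* x :+ e :* x
                        := (o :+ e) :* (o :+ x)) refl 1# (fromℕ m * ε) ε ⟩
    (1# + ε) * (1# + fromℕ m * ε)
      ≲⟨ *-monoˡ-≤ (+-nonneg 0≤1 0≤ε) (bernoulli 0≤ε m) ⟩
    (1# + ε) * (1# + ε) ^ m ∎

  -- If `s N` exceeded `l`, the gap taken as `ε` would force some later term below `s N`.
  monotone⇒≤limit : ∀ {s l} → (∀ n → s n ≤ s (suc n)) → s ⟶ l → ∀ N → s N ≤ l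
  monotone⇒≤limit {s} {l} mono lim N l<sN
    with M , bound ← lim (s N - l) (0<y-x l<sN)
    = mono′ (ℕ.m≤n⊔m M N)
        (<-respʳ-≈ (trans (+-comm l _) ([x-y]+y (s N) l)) (proj₂ (bound (M ℕ.⊔ N) (ℕ.m≤m⊔n M N))))
    where
    mono″ : ∀ {m n} → m ℕ.≤′ n → s m ≤ s n
    mono″ ℕ.≤′-refl         = ≤-refl
    mono″ (ℕ.≤′-step m≤n)   = ≤-trans (mono″ m≤n) (mono _)
    mono′ : ∀ {m n} → m ℕ.≤ n → s m ≤ s n
    mono′ = mono″ ∘ ℕ.≤⇒≤′

-- Expectations over words

infix 4 _≗ʷ?_
_≗ʷ?_ : ∀ (u v : Word n) → Dec (∀ j → u j ≡ v j)
u ≗ʷ? v = Fin.all? λ j → u j ℤ.≟ v j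

module WordEnumeration {c ℓ} (S : CommutativeSemiring c ℓ) where
  open CommutativeSemiring S hiding (zero)
  open ListSum S
  open SetoidReasoning setoid

  ∑-upTo-suc : ∀ N f → ∑ (upTo (suc N)) f ≡ f 0 + ∑ (upTo N) (f ∘ suc)
  ∑-upTo-suc N f = ≡.cong (f 0 +_)
    (≡.trans (≡.cong (λ xs → ∑ xs f) (≡.sym (List.map-upTo suc N))) (∑-map suc (upTo N) f))

  ∑-upTo-∷ʳ : ∀ N f → ∑ (upTo (suc N)) f ≈ ∑ (upTo N) f + f N
  ∑-upTo-∷ʳ N f = begin
    ∑ (upTo (suc N)) f            ≡⟨ ≡.cong (λ xs → ∑ xs f) (List.upTo-∷ʳ N) ⟨
    ∑ (upTo N ++ List.[ N ]) f    ≈⟨ ∑-++ (upTo N) List.[ N ] f ⟩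
    ∑ (upTo N) f + (f N + 0#)     ≈⟨ +-congˡ (+-identityʳ (f N)) ⟩
    ∑ (upTo N) f + f N ∎

  ∑-letters : ∀ N f → ∑ (letters N) f ≈
              f 0ℤ + (∑ (upTo N) (f ∘ +[1+_]) + ∑ (upTo N) (f ∘ -[1+_]))
  ∑-letters N f = +-congˡ (trans (∑-++ (List.map +[1+_] (upTo N)) _ f)
    (reflexive (≡.cong₂ _+_ (∑-map +[1+_] (upTo N) f) (∑-map -[1+_] (upTo N) f))))

  -- Membership in the truncated alphabet, in the form of the multiplicity that `∑-reindex` asks
  -- for. It has to be tracked because a word may have letters outside the alphabet.
  Single : ℕ → ℤ → Set ℓ
  Single N x = ∑ (letters N) (λ y → ⟦ does (y ℤ.≟ x) ⟧) ≈ 1#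

  private
    ∑-δ-upTo : ∀ {k N} → k ℕ.< N → ∑ (upTo N) (λ i → ⟦ does (i ℕ.≟ k) ⟧) ≈ 1#
    ∑-δ-upTo {zero}  {suc N} _ = trans (reflexive (∑-upTo-suc N _))
      (trans (+-congˡ (∑-zero (upTo N))) (+-identityʳ 1#))
    ∑-δ-upTo {suc k} {suc N} (ℕ.s≤s k<N) = trans (reflexive (∑-upTo-suc N _))
      (trans (+-identityˡ _) (∑-δ-upTo k<N))

  single-letters : ∀ N → All (Single N) (letters N)
  single-letters N = zero-single ∷ All.++⁺
    (All.map⁺ (All.map pos-single (All.all-upTo N)))
    (All.map⁺ (All.map neg-single (All.all-upTo N)))
    where
    zero-single : Single N 0ℤ
    zero-single = trans (∑-letters N _)
      (trans (+-congˡ (trans (+-cong (∑-zero (upTo N)) (∑-zero (upTo N))) (+-identityʳ 0#)))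
        (+-identityʳ 1#))
    pos-single : ∀ {k} → k ℕ.< N → Single N +[1+ k ]
    pos-single k<N = trans (∑-letters N _) (trans (+-identityˡ _)
      (trans (+-cong (∑-δ-upTo k<N) (∑-zero (upTo N))) (+-identityʳ 1#)))
    neg-single : ∀ {k} → k ℕ.< N → Single N -[1+ k ]
    neg-single k<N = trans (∑-letters N _) (trans (+-identityˡ _)
      (trans (+-cong (∑-zero (upTo N)) (∑-δ-upTo k<N)) (+-identityˡ 1#)))

  single-words : ∀ N n → All (λ v → ∀ j → Single N (v j)) (words N n)
  single-words N zero    = (λ ()) ∷ []
  single-words N (suc n) = cartesian (single-letters N)
    where
    cartesian : ∀ {xs} → All (Single N) xs →
      All (λ v → ∀ j → Single N (v j)) (cartesianProductWith Vector._∷_ xs (words N n))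
    cartesian []         = []
    cartesian (px ∷ pxs) = All.++⁺
      (All.map⁺ (All.map (λ pv → λ { zero → px ; (suc j) → pv j }) (single-words N n)))
      (cartesian pxs)

  ∑-δ-words : ∀ N n (u : Word n) → (∀ j → Single N (u j)) →
              ∑ (words N n) (λ v → ⟦ does (v ≗ʷ? u) ⟧) ≈ 1#
  ∑-δ-words N zero    u single = +-identityʳ 1#
  ∑-δ-words N (suc n) u single = begin
    ∑ (words N (suc n)) (λ v → ⟦ does (v ≗ʷ? u) ⟧)
      ≈⟨ ∑-cartesianProductWith Vector._∷_ (letters N) (words N n) _ ⟩
    ∑ (letters N) (λ x → ∑ (words N n) λ v → ⟦ does ((x Vector.∷ v) ≗ʷ? u) ⟧)
      ≈⟨ ∑-cong (letters N) (λ x → ∑-cong (words N n) λ v → trans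
           (⟦⟧-⇔ ((x Vector.∷ v) ≗ʷ? u) ((x ℤ.≟ u zero) ×-dec (v ≗ʷ? Vector.tail u))
             (λ eq → eq zero , eq ∘ suc)
             (λ { (eq , eqs) zero → eq ; (eq , eqs) (suc j) → eqs j }))
           (⟦∧⟧ (does (x ℤ.≟ u zero)) _)) ⟩
    ∑ (letters N) (λ x → ∑ (words N n) λ v →
      ⟦ does (x ℤ.≟ u zero) ⟧ * ⟦ does (v ≗ʷ? Vector.tail u) ⟧)
      ≈⟨ ∑-cong (letters N) (λ x → trans
           (sym (*-distribˡ-∑ ⟦ does (x ℤ.≟ u zero) ⟧ (words N n) (λ v → ⟦ does (v ≗ʷ? Vector.tail u) ⟧)))
           (trans (*-congˡ (∑-δ-words N n (Vector.tail u) (single ∘ suc))) (*-identityʳ _))) ⟩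
    ∑ (letters N) (λ x → ⟦ does (x ℤ.≟ u zero) ⟧)
      ≈⟨ single zero ⟩
    1# ∎

  ∑-words-permute : ∀ N (s : Permutation′ n) {f g} →
    (∀ u v → (∀ j → v j ≡ u (s ⟨$⟩ʳ j)) → f u ≈ g v) →
    ∑ (words N n) f ≈ ∑ (words N n) g
  ∑-words-permute {n} N s f≈g = ∑-reindex
    (λ u v → does (v ≗ʷ? (u ∘ (s ⟨$⟩ʳ_)))) (words N n) (words N n)
    (All.map (λ {u} single → ∑-δ-words N n _ (single ∘ (s ⟨$⟩ʳ_))) (single-words N n))
    (All.map (λ {v} single → trans
      (∑-cong (words N n) λ u → ⟦⟧-⇔ (v ≗ʷ? (u ∘ (s ⟨$⟩ʳ_))) (u ≗ʷ? (v ∘ (s ⟨$⟩ˡ_)))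
        (λ eq j → ≡.trans (≡.cong u (≡.sym (Perm.inverseʳ s))) (≡.sym (eq _)))
        (λ eq j → ≡.trans (≡.cong v (≡.sym (Perm.inverseˡ s))) (≡.sym (eq _))))
      (∑-δ-words N n _ (single ∘ (s ⟨$⟩ˡ_)))) (single-words N n))
    (λ u v p → f≈g u v (does-true⇒ (v ≗ʷ? (u ∘ (s ⟨$⟩ʳ_))) p))

-- Independent letters from a truncated alphabet

module FiniteAlphabet {c ℓ₁ ℓ₂} (R : RealField c ℓ₁ ℓ₂) where
  open RealField R hiding (zero)
  open Shuffles R
  open RealFieldProperties R
  open ListSum (RealField.commutativeSemiring R)
  open WordEnumeration (RealField.commutativeSemiring R)
  open PreorderReasoning ≤-preorder

  module Words (α β : ℕ → ℝ) (γ : ℝ) (0≤α : ∀ i → 0# ≤ α i) (0≤β : ∀ i → 0# ≤ β i) (0≤γ : 0# ≤ γ)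
               where

    p : ℤ → ℝ
    p = letterProb α β γ

    P[_] : Word n → ℝ
    P[_] = wordProb α β γ

    p-nonneg : ∀ x → 0# ≤ p x
    p-nonneg +[1+ i ] = 0≤α i
    p-nonneg -[1+ i ] = 0≤β i
    p-nonneg +0       = 0≤γ

    P-nonneg : ∀ (u : Word n) → 0# ≤ P[ u ]
    P-nonneg {zero}  u = 0≤1
    P-nonneg {suc n} u = *-nonneg (p-nonneg (u zero)) (P-nonneg (Vector.tail u))

    P-permute : ∀ (s : Permutation′ n) u v → (∀ j → v j ≡ u (s ⟨$⟩ʳ j)) → P[ v ] ≈ P[ u ]
    P-permute s u v v≡u∘s = begin-equality
      P[ v ]                            ≡⟨ P≡product v ⟩
      product (p ∘ v)                   ≡⟨ sum-cong-≗ (λ j → ≡.cong p (v≡u∘s j)) ⟩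
      product (p ∘ u ∘ (s ⟨$⟩ʳ_))       ≈⟨ sum-permute (p ∘ u) s ⟨
      product (p ∘ u)                   ≡⟨ P≡product u ⟨
      P[ u ] ∎
      where
      open CommutativeMonoidSum *-commutativeMonoid
        using (sum-permute; sum-cong-≗) renaming (sum to product)
      P≡product : ∀ {n} (u : Word n) → P[ u ] ≡ product (p ∘ u)
      P≡product {zero}  u = ≡.refl
      P≡product {suc n} u = ≡.cong (p (u zero) *_) (P≡product (Vector.tail u))

    module _ (N : ℕ) where

      -- At most 1, but equality need not hold: the letters are cut off at N.
      mass : ℝ
      mass = ∑ (letters N) p

      𝔼 : ∀ n → (Word n → ℝ) → ℝ
      𝔼 n f = ∑ (words N n) (λ u → P[ u ] * f u)

      𝔼-suc : ∀ n f → 𝔼 (suc n) f ≈ ∑ (letters N) (λ x → p x * 𝔼 n (λ u → f (x Vector.∷ u)))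
      𝔼-suc n f = trans (∑-cartesianProductWith Vector._∷_ (letters N) (words N n) _)
        (∑-cong (letters N) λ x → trans
          (∑-cong (words N n) λ u → *-assoc (p x) P[ u ] _)
          (sym (*-distribˡ-∑ (p x) (words N n) _)))

      𝔼-cong : ∀ n {f g} → (∀ u → f u ≈ g u) → 𝔼 n f ≈ 𝔼 n g
      𝔼-cong n f≈g = ∑-cong (words N n) λ u → *-congˡ (f≈g u)

      𝔼-nonneg : ∀ n {f} → (∀ u → 0# ≤ f u) → 0# ≤ 𝔼 n f
      𝔼-nonneg n 0≤f = ∑-nonneg (words N n) λ u → *-nonneg (P-nonneg u) (0≤f u)

      𝔼-one : ∀ n → 𝔼 n (λ _ → 1#) ≈ mass ^ n
      𝔼-one zero    = trans (+-identityʳ _) (*-identityʳ 1#)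
      𝔼-one (suc n) = trans (𝔼-suc n _) (trans
        (sym (*-distribʳ-∑ (𝔼 n (λ _ → 1#)) (letters N) p)) (*-congˡ (𝔼-one n)))

      mass-nonneg : 0# ≤ mass
      mass-nonneg = ∑-nonneg (letters N) p-nonneg

      squares : ℝ
      squares = ∑ (upTo N) (λ i → α i ^ 2) + ∑ (upTo N) (λ i → β i ^ 2)

      squares-nonneg : 0# ≤ squares
      squares-nonneg = +-nonneg
        (∑-nonneg (upTo N) λ i → ^-nonneg (0≤α i) 2) (∑-nonneg (upTo N) λ i → ^-nonneg (0≤β i) 2)

      module _ (mass≤1 : mass ≤ 1#) where

        mass*-≤ : ∀ {x} → 0# ≤ x → mass * x ≤ x
        mass*-≤ 0≤x = ≤-trans (*-monoʳ-≤ 0≤x mass≤1) (≤-reflexive (*-identityˡ _))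

        -- Only an inequality, because each of the other letters contributes a factor `mass`, which
        -- is at most 1.
        𝔼-marginal : ∀ n (j : Fin n) (g : ℤ → ℝ) → (∀ x → 0# ≤ g x) →
                     𝔼 n (λ u → g (u j)) ≤ ∑ (letters N) (λ x → p x * g x)
        𝔼-marginal (suc n) zero g 0≤g = begin
          𝔼 (suc n) (λ u → g (u zero))                    ≈⟨ 𝔼-suc n _ ⟩
          ∑ (letters N) (λ x → p x * 𝔼 n (λ _ → g x))     ≲⟨ ∑-mono-≤ (letters N) (λ x →
            *-monoˡ-≤ (p-nonneg x) (const≤ x)) ⟩
          ∑ (letters N) (λ x → p x * g x) ∎
          where
          const≤ : ∀ x → 𝔼 n (λ _ → g x) ≤ g x
          const≤ x = begin
            ∑ (words N n) (λ u → P[ u ] * g x)         ≈⟨ ∑-cong (words N n) (λ u → *-congʳ (sym (*-identityʳ P[ u ]))) ⟩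
            ∑ (words N n) (λ u → P[ u ] * 1# * g x)    ≈⟨ *-distribʳ-∑ (g x) (words N n) _ ⟨
            𝔼 n (λ _ → 1#) * g x                       ≈⟨ *-congʳ (𝔼-one n) ⟩
            mass ^ n * g x                             ≲⟨ *-monoʳ-≤ (0≤g x) (x^n≤1 mass-nonneg mass≤1 n) ⟩
            1# * g x                                   ≈⟨ *-identityˡ (g x) ⟩
            g x ∎
        𝔼-marginal (suc n) (suc j) g 0≤g = begin
          𝔼 (suc n) (λ u → g (u (suc j)))                     ≈⟨ 𝔼-suc n _ ⟩
          ∑ (letters N) (λ x → p x * 𝔼 n (λ u → g (u j)))     ≈⟨ *-distribʳ-∑ _ (letters N) p ⟨
          mass * 𝔼 n (λ u → g (u j))                          ≲⟨ mass*-≤ (𝔼-nonneg n (λ u → 0≤g (u j))) ⟩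
          𝔼 n (λ u → g (u j))                                 ≲⟨ 𝔼-marginal n j g 0≤g ⟩
          ∑ (letters N) (λ x → p x * g x) ∎

        𝔼-marginal₂ : ∀ n (i j : Fin n) → i ≢ j → ∀ (g : ℤ → ℤ → ℝ) → (∀ x y → 0# ≤ g x y) →
          𝔼 n (λ u → g (u i) (u j)) ≤
          ∑ (letters N) (λ x → p x * ∑ (letters N) (λ y → p y * g x y))
        𝔼-marginal₂ (suc n) zero zero i≢j g 0≤g = contradiction ≡.refl i≢j
        𝔼-marginal₂ (suc n) zero (suc j) i≢j g 0≤g = begin
          𝔼 (suc n) (λ u → g (u zero) (u (suc j)))               ≈⟨ 𝔼-suc n _ ⟩
          ∑ (letters N) (λ x → p x * 𝔼 n (λ u → g x (u j)))      ≲⟨ ∑-mono-≤ (letters N) (λ x →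
            *-monoˡ-≤ (p-nonneg x) (𝔼-marginal n j (g x) (0≤g x))) ⟩
          ∑ (letters N) (λ x → p x * ∑ (letters N) (λ y → p y * g x y)) ∎
        𝔼-marginal₂ (suc n) (suc i) zero i≢j g 0≤g = begin
          𝔼 (suc n) (λ u → g (u (suc i)) (u zero))
            -- The preceding clause for `g` with its arguments exchanged; the double sum is then put
            -- back in order.
            ≲⟨ 𝔼-marginal₂ (suc n) zero (suc i) (λ ()) (λ x y → g y x) (λ x y → 0≤g y x) ⟩
          ∑ (letters N) (λ x → p x * ∑ (letters N) (λ y → p y * g y x))
            ≈⟨ ∑-cong (letters N) (λ x → *-distribˡ-∑ (p x) (letters N) (λ y → p y * g y x)) ⟩
          ∑ (letters N) (λ x → ∑ (letters N) (λ y → p x * (p y * g y x)))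
            ≈⟨ ∑-swap (letters N) (letters N) (λ x y → p x * (p y * g y x)) ⟩
          ∑ (letters N) (λ y → ∑ (letters N) (λ x → p x * (p y * g y x)))
            ≈⟨ ∑-cong (letters N) (λ y → ∑-cong (letters N) (λ x → trans (sym (*-assoc _ _ _))
                 (trans (*-congʳ (*-comm _ _)) (*-assoc _ _ _)))) ⟩
          ∑ (letters N) (λ y → ∑ (letters N) (λ x → p y * (p x * g y x)))
            ≈⟨ ∑-cong (letters N) (λ y → *-distribˡ-∑ (p y) (letters N) (λ x → p x * g y x)) ⟨
          ∑ (letters N) (λ y → p y * ∑ (letters N) (λ x → p x * g y x)) ∎
        𝔼-marginal₂ (suc n) (suc i) (suc j) i≢j g 0≤g = begin
          𝔼 (suc n) (λ u → g (u (suc i)) (u (suc j)))                 ≈⟨ 𝔼-suc n _ ⟩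
          ∑ (letters N) (λ x → p x * 𝔼 n (λ u → g (u i) (u j)))       ≈⟨ *-distribʳ-∑ _ (letters N) p ⟨
          mass * 𝔼 n (λ u → g (u i) (u j))
            ≲⟨ mass*-≤ (𝔼-nonneg n (λ u → 0≤g (u i) (u j))) ⟩
          𝔼 n (λ u → g (u i) (u j))
            ≲⟨ 𝔼-marginal₂ n i j (i≢j ∘ ≡.cong suc) g 0≤g ⟩
          ∑ (letters N) (λ x → p x * ∑ (letters N) (λ y → p y * g x y)) ∎

        -- Two independent letters coincide only on the diagonal of the double sum, which
        -- contributes the square of each letter's probability. The term of the letter 0 vanishes,
        -- since two zeros do not clash; hence `γ` does not appear in the bound.
        𝔼-clash : ∀ n {i j : Fin n} → i ≢ j → 𝔼 n (λ u → ⟦ clash u i j ⟧) ≤ squares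
        𝔼-clash n {i} {j} i≢j = begin
          𝔼 n (λ u → ⟦ clash u i j ⟧)
            ≲⟨ 𝔼-marginal₂ n i j i≢j (λ x y → ⟦ does (x ℤ.≟ y) ∧ nonzero x ⟧) (λ x y → ⟦⟧-nonneg (does (x ℤ.≟ y) ∧ nonzero x)) ⟩
          ∑ (letters N) (λ x → p x * ∑ (letters N) (λ y → p y * ⟦ does (x ℤ.≟ y) ∧ nonzero x ⟧))
            ≈⟨ ∑-cong-All (single-letters N) (λ {x} single → *-congˡ (diagonal x single)) ⟩
          ∑ (letters N) (λ x → p x * (p x * ⟦ nonzero x ⟧))
            ≈⟨ ∑-letters N _ ⟩
          -- `α i * (α i * 1#)` unfolds from `α i ^ 2`, and likewise for `β`.
          γ * (γ * 0#) + (∑ (upTo N) (λ i → α i ^ 2) + ∑ (upTo N) (λ i → β i ^ 2))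
            ≈⟨ trans (+-congʳ (trans (*-congˡ (zeroʳ γ)) (zeroʳ γ))) (+-identityˡ _) ⟩
          squares ∎
          where
          nonzero : ℤ → Bool
          nonzero x = not (does (x ℤ.≟ 0ℤ))
          diagonal : ∀ x → Single N x →
            ∑ (letters N) (λ y → p y * ⟦ does (x ℤ.≟ y) ∧ nonzero x ⟧) ≈ p x * ⟦ nonzero x ⟧
          diagonal x single = begin-equality
            ∑ (letters N) (λ y → p y * ⟦ does (x ℤ.≟ y) ∧ nonzero x ⟧)
              ≈⟨ ∑-cong (letters N) term ⟩
            ∑ (letters N) (λ y → p x * ⟦ nonzero x ⟧ * ⟦ does (y ℤ.≟ x) ⟧)
              ≈⟨ *-distribˡ-∑ (p x * ⟦ nonzero x ⟧) (letters N) (λ y → ⟦ does (y ℤ.≟ x) ⟧) ⟨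
            p x * ⟦ nonzero x ⟧ * ∑ (letters N) (λ y → ⟦ does (y ℤ.≟ x) ⟧)
              ≈⟨ *-congˡ single ⟩
            p x * ⟦ nonzero x ⟧ * 1#
              ≈⟨ *-identityʳ _ ⟩
            p x * ⟦ nonzero x ⟧ ∎
            where
            term : ∀ y → p y * ⟦ does (x ℤ.≟ y) ∧ nonzero x ⟧ ≈ p x * ⟦ nonzero x ⟧ * ⟦ does (y ℤ.≟ x) ⟧
            term y with x ℤ.≟ y | y ℤ.≟ x
            ... | yes ≡.refl | yes _  = sym (*-identityʳ _)
            ... | yes ≡.refl | no y≢y = contradiction ≡.refl y≢y
            ... | no x≢y     | yes eq = contradiction (≡.sym eq) x≢y
            ... | no _       | no _   = trans (zeroʳ _) (sym (zeroʳ _))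

-- Separated pairs of cards

Relation : ℕ → Set
Relation n = Fin n → Fin n → Bool

infix 8 _ᵘ
-- Whether a pair remains to be separated must not depend on its direction, which an exchange of
-- cards may reverse. The relation itself stays directed so that `size` can count each pair once.
_ᵘ : Relation n → Relation n
(E ᵘ) i j = E i j or E j i

-- The pairs left over by the step, renamed by the positions to which `τ` takes the cards.
push : Relation n → Word n → Permutation′ n → Relation n
push E u τ i j = E (τ ⟨$⟩ˡ i) (τ ⟨$⟩ˡ j) ∧ clash u (τ ⟨$⟩ˡ i) (τ ⟨$⟩ˡ j)

Empty? : (E : Relation n) → Dec (∀ i j → E i j ≡ false)
Empty? E = Fin.all? λ i → Fin.all? λ j → E i j Bool.≟ false

clash-sym : ∀ (u : Word n) i j → clash u i j ≡ clash u j i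
clash-sym u i j with u i ℤ.≟ u j | u j ℤ.≟ u i
... | yes ui≡uj | yes _      = ≡.cong (λ x → not (does (x ℤ.≟ 0ℤ))) ui≡uj
... | yes ui≡uj | no uj≢ui   = contradiction (≡.sym ui≡uj) uj≢ui
... | no ui≢uj  | yes uj≡ui  = contradiction (≡.sym uj≡ui) ui≢uj
... | no _      | no _       = ≡.refl

push-ᵘ : ∀ (E : Relation n) u τ i j → (push E u τ ᵘ) i j ≡
         (E ᵘ) (τ ⟨$⟩ˡ i) (τ ⟨$⟩ˡ j) ∧ clash u (τ ⟨$⟩ˡ i) (τ ⟨$⟩ˡ j)
push-ᵘ E u τ i j rewrite clash-sym u (τ ⟨$⟩ˡ j) (τ ⟨$⟩ˡ i) =
  ≡.sym (Bool.∧-distribʳ-∨ (clash u (τ ⟨$⟩ˡ i) (τ ⟨$⟩ˡ j)) (E (τ ⟨$⟩ˡ i) (τ ⟨$⟩ˡ j)) _)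

empty-ᵘ : ∀ {E F : Relation n} → (∀ i j → (F ᵘ) i j ≡ (E ᵘ) i j) →
          (∀ i j → E i j ≡ false) → ∀ i j → F i j ≡ false
empty-ᵘ {E = E} {F} eq empty i j with F i j in Fij
... | false = ≡.refl
... | true  = ≡.trans (≡.cong (_or F j i) (≡.sym Fij)) (≡.trans (eq i j)
  (≡.cong₂ _or_ (empty i j) (empty j i)))

-- The initial relation: all pairs, each in one direction. After symmetrising it becomes inequality,
-- which every permutation preserves.
ascending : ∀ n → Relation n
ascending n i j = does (i Fin.<? j)

ascending-ᵘ : ∀ (i j : Fin n) → (ascending n ᵘ) i j ≡ not (does (i Fin.≟ j))
ascending-ᵘ i j with Fin.<-cmp i j
... | tri< i<j i≢j _ rewrite dec-true (i Fin.<? j) i<j | dec-false (i Fin.≟ j) i≢j = ≡.refl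
... | tri≈ i≮j i≡j j≮i
  rewrite dec-false (i Fin.<? j) i≮j | dec-false (j Fin.<? i) j≮i | dec-true (i Fin.≟ j) i≡j = ≡.refl
... | tri> i≮j i≢j j<i
  rewrite dec-false (i Fin.<? j) i≮j | dec-true (j Fin.<? i) j<i | dec-false (i Fin.≟ j) i≢j = ≡.refl

adjacent? : ∀ (i j : Fin n) → Dec (Adjacent i j)
adjacent? i j = (toℕ j ℕ.≟ suc (toℕ i)) ⊎-dec (toℕ i ℕ.≟ suc (toℕ j))

adjacent⇒≢ : ∀ {i j : Fin n} → Adjacent i j → i ≢ j
adjacent⇒≢ (inj₁ eq) ≡.refl = ℕ.<-irrefl eq ℕ.≤-refl
adjacent⇒≢ (inj₂ eq) ≡.refl = ℕ.<-irrefl eq ℕ.≤-refl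

-- Functions on `Sₙ` invariant under adjacent transpositions are constant

module Invariance {c ℓ} (S : CommutativeSemiring c ℓ) where
  open CommutativeSemiring S using (Carrier; _≈_; trans; refl; sym)

  module _ {f : Permutation′ n → Carrier}
           (cong : ∀ {π σ} → (∀ j → π ⟨$⟩ʳ j ≡ σ ⟨$⟩ʳ j) → f π ≈ f σ)
           (adjacent : ∀ {i j} → Adjacent i j → ∀ π → f (transpose i j ∘ₚ π) ≈ f π) where

    private
      -- With k = j - 1, (i j) = (k j) (i k) (k j).
      at-distance : ∀ d i j → toℕ j ≡ suc (d ℕ.+ toℕ i) → ∀ π → f (transpose i j ∘ₚ π) ≈ f π
      at-distance zero    i j eq π = adjacent (inj₁ eq) π
      at-distance (suc d) i j eq π = trans (cong conjugate) (trans (adjacent (inj₂ j-k) _)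
        (trans (at-distance d i k k-i _) (adjacent (inj₁ j-k) _)))
        where
        k<n : suc (d ℕ.+ toℕ i) ℕ.< n
        k<n = ℕ.<-trans (ℕ.≤-reflexive (≡.sym eq)) (Fin.toℕ<n j)
        k : Fin n
        k = Fin.fromℕ< k<n
        k-i : toℕ k ≡ suc (d ℕ.+ toℕ i)
        k-i = Fin.toℕ-fromℕ< k<n
        j-k : toℕ j ≡ suc (toℕ k)
        j-k = ≡.trans eq (≡.cong suc (≡.sym k-i))
        i<k : i Fin.< k
        i<k = ℕ.≤-trans (ℕ.s≤s (ℕ.m≤n+m (toℕ i) d)) (ℕ.≤-reflexive (≡.sym k-i))
        i<j : i Fin.< j
        i<j = ℕ.<-trans i<k (ℕ.≤-reflexive (≡.sym j-k))
        s : Permutation′ n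
        s = transpose k j
        conjugate : ∀ l → transpose i j ∘ₚ π ⟨$⟩ʳ l ≡
          transpose j k ∘ₚ (transpose i k ∘ₚ (transpose k j ∘ₚ π)) ⟨$⟩ʳ l
        conjugate l = ≡.cong (π ⟨$⟩ʳ_) (≡.sym (≡.trans
          (≡.trans (transpose-conjugate s i k (transpose j k ⟨$⟩ʳ l))
            (≡.cong₂ (λ x y → transpose x y ⟨$⟩ʳ (s ⟨$⟩ʳ (transpose j k ⟨$⟩ʳ l)))
              (transpose-other k j (Fin.<⇒≢ i<k) (Fin.<⇒≢ i<j)) (transpose-ˡ k j)))
          (≡.cong (transpose i j ⟨$⟩ʳ_) (≡.trans (≡.cong (s ⟨$⟩ʳ_) (transpose-comm j k l))
            (transpose-involutive k j l)))))

      transposition : ∀ i j π → f (transpose i j ∘ₚ π) ≈ f π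
      transposition i j π with Fin.<-cmp i j
      ... | tri< i<j _ _ = at-distance (toℕ j ℕ.∸ suc (toℕ i)) i j
        (≡.sym (≡.trans (≡.sym (ℕ.+-suc _ (toℕ i))) (ℕ.m∸n+n≡m i<j))) π
      ... | tri≈ _ ≡.refl _ = cong λ l → ≡.cong (π ⟨$⟩ʳ_) (fixed l)
        where
        fixed : ∀ l → transpose i i ⟨$⟩ʳ l ≡ l
        fixed l with transpose i i ⟨$⟩ʳ l | view i i l
        ... | _ | atˡ       = ≡.refl
        ... | _ | atʳ       = ≡.refl
        ... | _ | other _ _ = ≡.refl
      ... | tri> _ _ j<i = trans (cong λ l → ≡.cong (π ⟨$⟩ʳ_) (transpose-comm i j l))
        (at-distance (toℕ i ℕ.∸ suc (toℕ j)) j i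
          (≡.sym (≡.trans (≡.sym (ℕ.+-suc _ (toℕ j))) (ℕ.m∸n+n≡m j<i))) π)

      evaluate : ∀ ts → f (eval ts) ≈ f Perm.id
      evaluate []             = refl
      evaluate ((i , j) ∷ ts) = trans (transposition i j (eval ts)) (evaluate ts)

    constant : ∀ π → f π ≈ f Perm.id
    constant π = trans (cong (λ l → ≡.sym (eval-decompose π l))) (evaluate (decompose π))

-- Convolution powers by first and by last steps

module Convolution {c ℓ₁ ℓ₂} (R : RealField c ℓ₁ ℓ₂) where
  open RealField R hiding (zero)
  open Shuffles R
  open RealFieldProperties R
  open ListSum (RealField.commutativeSemiring R)
  open PreorderReasoning ≤-preorder

  -- Convolution powers with the first step split off; ⋆^ splits off the last.
  power : Weight n → ℕ → Weight n
  power P zero    π = ⟦ does (π ≈ₚ? Perm.id) ⟧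
  power P (suc k) π = ∑ (allPerms _) λ τ → P τ * power P k (flip τ ∘ₚ π)

  power-cong : ∀ (P : Weight n) k {π σ} → (∀ j → π ⟨$⟩ʳ j ≡ σ ⟨$⟩ʳ j) → power P k π ≈ power P k σ
  power-cong P zero {π} {σ} π≡σ = ⟦⟧-⇔ (π ≈ₚ? Perm.id) (σ ≈ₚ? Perm.id)
    (λ eq j → ≡.trans (≡.sym (π≡σ j)) (eq j)) (λ eq j → ≡.trans (π≡σ j) (eq j))
  power-cong P (suc k) π≡σ = ∑-cong (allPerms _) λ τ → *-congˡ (power-cong P k (λ j → π≡σ (τ ⟨$⟩ˡ j)))

  -- The first step is removed on one side of `π` and the last on the other, so the two removals
  -- commute. When a single step is left, both ask that `π` equal `τ`.
  ⋆-power : ∀ (P : Weight n) k π → (P ⋆ power P k) π ≈ power P (suc k) π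
  ⋆-power P zero π = ∑-cong (allPerms _) λ τ → *-congˡ
    (⟦⟧-⇔ ((π ∘ₚ flip τ) ≈ₚ? Perm.id) ((flip τ ∘ₚ π) ≈ₚ? Perm.id)
      (λ eq j → ≡.trans (≡.sym (Perm.inverseʳ τ)) (≡.trans (≡.cong (τ ⟨$⟩ʳ_) (eq (τ ⟨$⟩ˡ j))) (Perm.inverseʳ τ)))
      (λ eq j → ≡.trans (≡.cong (λ i → τ ⟨$⟩ˡ (π ⟨$⟩ʳ i)) (≡.sym (Perm.inverseˡ τ)))
        (≡.trans (≡.cong (τ ⟨$⟩ˡ_) (eq (τ ⟨$⟩ʳ j))) (Perm.inverseˡ τ))))
  ⋆-power {n} P (suc k) π = begin-equality
    ∑ perms (λ σ → P σ * ∑ perms λ τ → P τ * power P k (flip τ ∘ₚ (π ∘ₚ flip σ)))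
      ≈⟨ ∑-cong perms (λ σ → *-distribˡ-∑ (P σ) perms (λ τ → P τ * power P k (flip τ ∘ₚ (π ∘ₚ flip σ)))) ⟩
    ∑ perms (λ σ → ∑ perms λ τ → P σ * (P τ * power P k (flip τ ∘ₚ (π ∘ₚ flip σ))))
      ≈⟨ ∑-swap perms perms (λ σ τ → P σ * (P τ * power P k (flip τ ∘ₚ (π ∘ₚ flip σ)))) ⟩
    ∑ perms (λ τ → ∑ perms λ σ → P σ * (P τ * power P k (flip τ ∘ₚ (π ∘ₚ flip σ))))
      ≈⟨ ∑-cong perms (λ τ → ∑-cong perms λ σ → trans (sym (*-assoc _ _ _))
           (trans (*-congʳ (*-comm _ _)) (trans (*-assoc _ _ _)
             (*-congˡ (*-congˡ (power-cong P k {flip τ ∘ₚ (π ∘ₚ flip σ)} {(flip τ ∘ₚ π) ∘ₚ flip σ} λ _ → ≡.refl)))))) ⟩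
    ∑ perms (λ τ → ∑ perms λ σ → P τ * (P σ * power P k ((flip τ ∘ₚ π) ∘ₚ flip σ)))
      ≈⟨ ∑-cong perms (λ τ → *-distribˡ-∑ (P τ) perms (λ σ → P σ * power P k ((flip τ ∘ₚ π) ∘ₚ flip σ))) ⟨
    ∑ perms (λ τ → P τ * (P ⋆ power P k) (flip τ ∘ₚ π))
      ≈⟨ ∑-cong perms (λ τ → *-congˡ (⋆-power P k (flip τ ∘ₚ π))) ⟩
    power P (suc (suc k)) π ∎
    where
    perms : List (Permutation′ n)
    perms = allPerms n

  ⋆^≈power : ∀ (P : Weight n) k π → (P ⋆^ k) π ≈ power P k π
  ⋆^≈power P zero π with does (π ≈ₚ? Perm.id)
  ... | true  = refl
  ... | false = refl
  ⋆^≈power P (suc k) π = trans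
    (∑-cong (allPerms _) λ σ → *-congˡ (⋆^≈power P k (π ∘ₚ flip σ))) (⋆-power P k π)

-- Uniformity on the separated event, and the union bound

module Separation {c ℓ₁ ℓ₂} (R : RealField c ℓ₁ ℓ₂) where
  open RealField R hiding (zero)
  open Shuffles R
  open RealFieldProperties R
  open ListSum (RealField.commutativeSemiring R)
  open Enumeration (RealField.commutativeSemiring R)
  open WordEnumeration (RealField.commutativeSemiring R)
  open FiniteAlphabet R
  open Convolution R
  open PreorderReasoning ≤-preorder

  module Truncated (α β : ℕ → ℝ) (γ : ℝ)
                   (0≤α : ∀ i → 0# ≤ α i) (0≤β : ∀ i → 0# ≤ β i) (0≤γ : 0# ≤ γ) (N : ℕ) where

    open Words α β γ 0≤α 0≤β 0≤γ

    G : Word n → Weight n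
    G = givenWord α β γ

    -- By definition the term at `N` of the sequence whose limit `IsShuffle` requires.
    W : Weight n
    W {n} π = 𝔼 N n (λ u → G u π)

    G-cong : ∀ {u v : Word n} {π σ} → zeros v ≡ zeros u → orders v σ ≡ orders u π → G v σ ≈ G u π
    G-cong zeros≡ orders≡ = reflexive (≡.cong₂ (λ k m → fromℕ k * recip (!>0 m)) orders≡ zeros≡)

    G-nonneg : ∀ (u : Word n) π → 0# ≤ G u π
    G-nonneg u π = *-nonneg (fromℕ-nonneg (orders u π)) (<⇒≤ (recip>0 (!>0 (zeros u))))

    ∑-G : ∀ (u : Word n) → ∑ (allPerms n) (G u) ≈ 1#
    ∑-G {n} u = begin-equality
      ∑ (allPerms n) (G u)
        ≈⟨ *-distribʳ-∑ _ (allPerms n) (λ π → fromℕ (orders u π)) ⟨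
      ∑ (allPerms n) (λ π → fromℕ (orders u π)) * recip (!>0 (zeros u))
        ≈⟨ *-congʳ (fromℕ-∑ (allPerms n)) ⟨
      fromℕ (ListSum.∑ ℕ.+-*-commutativeSemiring (allPerms n) (orders u)) * recip (!>0 (zeros u))
        ≡⟨ ≡.cong (λ k → fromℕ k * recip (!>0 (zeros u))) (∑-orders u) ⟩
      fromℕ (zeros u !) * recip (!>0 (zeros u))
        ≈⟨ *-recip (!>0 (zeros u)) ⟩
      1# ∎
      where
      fromℕ-∑ : ∀ {a} {A : Set a} (xs : List A) {f : A → ℕ} →
        fromℕ (ListSum.∑ ℕ.+-*-commutativeSemiring xs f) ≈ ∑ xs (fromℕ ∘ f)
      fromℕ-∑ []           = refl
      fromℕ-∑ (x ∷ xs) {f} = trans (fromℕ-+ (f x) _) (+-congˡ (fromℕ-∑ xs))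

    -- Q k E π is the probability that k steps produce π and that every pair of
    -- cards related by E has, in some step, received different letters or twice
    -- the letter 0.
    Q : ℕ → Relation n → Weight n
    Q {n} zero    E π = ⟦ does (π ≈ₚ? Perm.id) ⟧ * ⟦ does (Empty? E) ⟧
    Q {n} (suc k) E π = 𝔼 N n λ u → ∑ (allPerms n) λ τ → G u τ * Q k (push E u τ) (flip τ ∘ₚ π)

    Q-cong : ∀ k {E F : Relation n} {π σ} → (∀ i j → (F ᵘ) i j ≡ (E ᵘ) i j) →
             (∀ j → σ ⟨$⟩ʳ j ≡ π ⟨$⟩ʳ j) → Q k F σ ≈ Q k E π
    Q-cong zero {E} {F} {π} {σ} F≡E σ≡π = *-cong
      (⟦⟧-⇔ (σ ≈ₚ? Perm.id) (π ≈ₚ? Perm.id)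
        (λ eq j → ≡.trans (≡.sym (σ≡π j)) (eq j)) (λ eq j → ≡.trans (σ≡π j) (eq j)))
      (⟦⟧-⇔ (Empty? F) (Empty? E)
        (empty-ᵘ {E = F} {E} (λ i j → ≡.sym (F≡E i j))) (empty-ᵘ {E = E} {F} F≡E))
    Q-cong {n} (suc k) {E} {F} F≡E σ≡π = 𝔼-cong N n λ u → ∑-cong (allPerms n) λ τ → *-congˡ
      (Q-cong k
        (λ i j → ≡.trans (push-ᵘ F u τ i j) (≡.trans
          (≡.cong (_∧ clash u (τ ⟨$⟩ˡ i) (τ ⟨$⟩ˡ j)) (F≡E (τ ⟨$⟩ˡ i) (τ ⟨$⟩ˡ j)))
          (≡.sym (push-ᵘ E u τ i j))))
        (λ j → σ≡π (τ ⟨$⟩ˡ j)))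

    -- If the adjacent cards i and j are to be separated, exchanging them does not
    -- change the probability: in the first step either they are separated, and
    -- exchanging their letters exchanges their new positions, or they become
    -- neighbours again.
    Q-swap : ∀ k {E F : Relation n} {π σ i j} → Adjacent i j → (E ᵘ) i j ≡ true →
      (∀ a b → (F ᵘ) a b ≡ (E ᵘ) (transpose i j ⟨$⟩ʳ a) (transpose i j ⟨$⟩ʳ b)) →
      (∀ a → σ ⟨$⟩ʳ a ≡ π ⟨$⟩ʳ (transpose i j ⟨$⟩ʳ a)) →
      Q k E π ≈ Q k F σ
    -- With no step left, both sides vanish: the pair of `i` and `j` is still waiting in `E`, and
    -- therefore also in `F`.
    Q-swap zero {E} {F} {π} {σ} {i} {j} adj Eij F≡E∘s σ≡π∘s = trans
      (nonempty E λ empty → absurd (≡.trans (≡.sym Eij) (≡.cong₂ _or_ (empty i j) (empty j i))))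
      (sym (nonempty F λ empty → absurd (≡.trans (≡.sym Eji) (≡.trans (≡.sym (F≡E∘s i j))
        (≡.cong₂ _or_ (empty i j) (empty j i))))))
      where
      absurd : true ≢ false
      absurd ()
      Eji : (E ᵘ) (transpose i j ⟨$⟩ʳ i) (transpose i j ⟨$⟩ʳ j) ≡ true
      Eji = ≡.trans (≡.cong₂ (E ᵘ) (transpose-ˡ i j) (transpose-ʳ i j))
        (≡.trans (Bool.∨-comm (E j i) (E i j)) Eij)
      nonempty : ∀ {x} E → ¬ (∀ i j → E i j ≡ false) → x * ⟦ does (Empty? E) ⟧ ≈ 0#
      nonempty E ¬empty = trans (*-congˡ (⟦⟧-cong (dec-false (Empty? E) ¬empty))) (zeroʳ _)
    Q-swap {n} (suc k) {E} {F} {π} {σ} {i} {j} adj Eij F≡E∘s σ≡π∘s =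
      -- Each word is matched with the equally likely word in which `i` and `j` have exchanged
      -- letters.
      ∑-words-permute N s λ u v v≡u∘s →
        *-cong (sym (P-permute s u v v≡u∘s)) (step u v v≡u∘s)
      where
      s : Permutation′ n
      s = transpose i j

      term : Relation n → Word n → Permutation′ n → Permutation′ n → ℝ
      term E u τ π = G u τ * Q k (push E u τ) (flip τ ∘ₚ π)

      step : ∀ u v → (∀ a → v a ≡ u (s ⟨$⟩ʳ a)) →
             ∑ (allPerms n) (λ τ → term E u τ π) ≈ ∑ (allPerms n) (λ τ → term F v τ σ)
      step u v v≡u∘s with clash u i j in clash-eq
      -- Here `τ` is matched with `s ∘ₚ τ`. The exchange is undone by this step: what the remaining
      -- steps must produce and separate is the same on both sides, so `Q-cong` suffices.
      ... | false = ∑-precompose s separated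
        where
        separated : ∀ τ τ′ → (∀ a → τ′ ⟨$⟩ʳ a ≡ τ ⟨$⟩ʳ (s ⟨$⟩ʳ a)) → term E u τ π ≈ term F v τ′ σ
        separated τ τ′ τ′≡τ∘s = sym (*-cong
          (G-cong {u = u} {v} {τ} {τ′} (zeros-permute s v≡u∘s)
            (orders-swap u v τ τ′ adj clash-eq v≡u∘s τ′≡τ∘s))
          (Q-cong k same λ a → ≡.trans (σ≡π∘s _) (≡.cong (π ⟨$⟩ʳ_) (s-inverse a))))
          where
          s-inverse : ∀ a → s ⟨$⟩ʳ (τ′ ⟨$⟩ˡ a) ≡ τ ⟨$⟩ˡ a
          s-inverse a = permutation-injective τ (≡.trans (≡.sym (τ′≡τ∘s (τ′ ⟨$⟩ˡ a)))
            (≡.trans (Perm.inverseʳ τ′) (≡.sym (Perm.inverseʳ τ))))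
          same : ∀ a b → (push F v τ′ ᵘ) a b ≡ (push E u τ ᵘ) a b
          same a b = ≡.trans (push-ᵘ F v τ′ a b) (≡.trans
            (≡.cong₂ _∧_
              (≡.trans (F≡E∘s _ _) (≡.cong₂ (E ᵘ) (s-inverse a) (s-inverse b)))
              (clash-cong v u _ _ _ _
                (≡.trans (v≡u∘s _) (≡.cong u (s-inverse a)))
                (≡.trans (v≡u∘s _) (≡.cong u (s-inverse b)))))
            (≡.sym (push-ᵘ E u τ a b)))
      -- Exchanging equal letters does not change the word, and `τ` is matched with itself. Either
      -- `τ` parts the two cards, which has probability zero, or they are again neighbours, still
      -- unseparated, and the induction hypothesis applies to their new positions.
      ... | true = ∑-cong (allPerms n) together
        where
        u∘s≡u : ∀ a → u (s ⟨$⟩ʳ a) ≡ u a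
        u∘s≡u a with s ⟨$⟩ʳ a | view i j a
        ... | _ | atˡ       = ≡.sym (proj₁ (clash-true u i j clash-eq))
        ... | _ | atʳ       = proj₁ (clash-true u i j clash-eq)
        ... | _ | other _ _ = ≡.refl

        v≡u : ∀ a → v a ≡ u a
        v≡u a = ≡.trans (v≡u∘s a) (u∘s≡u a)

        together : ∀ τ → term E u τ π ≈ term F v τ σ
        together τ with adjacent? (τ ⟨$⟩ʳ i) (τ ⟨$⟩ʳ j)
        ... | no ¬adj′ = trans (trans (*-congʳ Gu≈0) (zeroˡ _))
          (sym (trans (*-congʳ (trans Gv≈Gu Gu≈0)) (zeroˡ _)))
          where
          Gv≈Gu : G v τ ≈ G u τ
          Gv≈Gu = G-cong {u = u} {v} {τ} {τ} (zeros-permute s v≡u∘s) (orders-cong {w = u} {v} {τ} {τ} v≡u (λ _ → ≡.refl))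
          Gu≈0 : G u τ ≈ 0#
          Gu≈0 = trans (*-congʳ (reflexive (≡.cong fromℕ (orders-clash u τ adj clash-eq ¬adj′)))) (zeroˡ _)
        ... | yes adj′ = *-cong
          (sym (G-cong {u = u} {v} {τ} {τ} (zeros-permute s v≡u∘s) (orders-cong {w = u} {v} {τ} {τ} v≡u (λ _ → ≡.refl))))
          (Q-swap k adj′
            (≡.trans (push-ᵘ E u τ _ _) (≡.cong₂ _∧_
              (≡.trans (≡.cong₂ (E ᵘ) (Perm.inverseˡ τ) (Perm.inverseˡ τ)) Eij)
              (≡.trans (≡.cong₂ (clash u) (Perm.inverseˡ τ) (Perm.inverseˡ τ)) clash-eq)))
            (λ a b → ≡.trans (push-ᵘ F v τ a b) (≡.trans
              (≡.cong₂ _∧_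
                (≡.trans (F≡E∘s _ _) (≡.cong₂ (E ᵘ) (s-inverse a) (s-inverse b)))
                (clash-cong v u _ _ _ _
                  (≡.trans (v≡u∘s _) (≡.cong u (s-inverse a)))
                  (≡.trans (v≡u∘s _) (≡.cong u (s-inverse b)))))
              (≡.sym (push-ᵘ E u τ _ _))))
            (λ a → ≡.trans (σ≡π∘s _) (≡.cong (π ⟨$⟩ʳ_) (s-inverse a))))
          where
          s-inverse : ∀ a → s ⟨$⟩ʳ (τ ⟨$⟩ˡ a) ≡ τ ⟨$⟩ˡ (transpose (τ ⟨$⟩ʳ i) (τ ⟨$⟩ʳ j) ⟨$⟩ʳ a)
          s-inverse a = permutation-injective τ (≡.trans (transpose-conjugate τ i j (τ ⟨$⟩ˡ a))
            (≡.trans (≡.cong (transpose (τ ⟨$⟩ʳ i) (τ ⟨$⟩ʳ j) ⟨$⟩ʳ_) (Perm.inverseʳ τ))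
              (≡.sym (Perm.inverseʳ τ))))

    -- The set of all pairs is mapped to itself by every exchange, so `Q-swap` can be used with
    -- `ascending n` on both sides.
    Q-constant : ∀ n k (π : Permutation′ n) → Q k (ascending n) π ≈ Q k (ascending n) Perm.id
    Q-constant n k = Invariance.constant (RealField.commutativeSemiring R)
      {f = Q k (ascending n)} (Q-cong k (λ _ _ → ≡.refl))
      λ {i} {j} adj π → sym (Q-swap k adj
        (≡.trans (ascending-ᵘ i j) (≡.cong not (dec-false (i Fin.≟ j) (adjacent⇒≢ adj))))
        (λ a b → ≡.trans (ascending-ᵘ a b) (≡.trans
          (≡.cong not (does-⇔ (mk⇔ (≡.cong (transpose i j ⟨$⟩ʳ_)) (permutation-injective (transpose i j)))
            (a Fin.≟ b) (transpose i j ⟨$⟩ʳ a Fin.≟ transpose i j ⟨$⟩ʳ b)))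
          (≡.sym (ascending-ᵘ (transpose i j ⟨$⟩ʳ a) (transpose i j ⟨$⟩ʳ b)))))
        (λ _ → ≡.refl))

    size : Relation n → ℝ
    size {n} E = ∑ (allFin n) λ i → ∑ (allFin n) λ j → ⟦ E i j ⟧

    -- Pascal's rule: card `zero` forms a pair with each of the `n` others.
    size-ascending : ∀ n → size (ascending n) ≈ fromℕ (n C 2)
    size-ascending zero    = refl
    size-ascending (suc n) = begin-equality
      size (ascending (suc n))
        ≡⟨ ∑-allFin-suc n (λ i → ∑ (allFin (suc n)) λ j → ⟦ ascending (suc n) i j ⟧) ⟩
      ∑ (allFin (suc n)) (λ j → ⟦ ascending (suc n) zero j ⟧) +
        ∑ (allFin n) (λ i → ∑ (allFin (suc n)) λ j → ⟦ ascending (suc n) (suc i) j ⟧)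
        ≈⟨ +-cong (trans (reflexive (∑-allFin-suc n _)) (trans (+-identityˡ _)
             (reflexive (≡.trans (∑-const (allFin n)) (≡.cong fromℕ (List.length-tabulate {n = n} id))))))
           (∑-cong (allFin n) λ i → trans (reflexive (∑-allFin-suc n _)) (+-identityˡ _)) ⟩
      fromℕ n + size (ascending n)
        ≈⟨ +-congˡ (size-ascending n) ⟩
      fromℕ n + fromℕ (n C 2)
        ≈⟨ fromℕ-+ n (n C 2) ⟨
      fromℕ (n ℕ.+ n C 2)
        ≡⟨ ≡.cong fromℕ (≡.trans (≡.cong (ℕ._+ n C 2) (≡.sym (nC1≡n n))) (nCk+nC[k+1]≡[n+1]C[k+1] n 1)) ⟩
      fromℕ (suc n C 2) ∎

    size-nonneg : ∀ (E : Relation n) → 0# ≤ size E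
    size-nonneg {n} E = ∑-nonneg (allFin n) λ i → ∑-nonneg (allFin n) λ j → ⟦⟧-nonneg (E i j)

    term≤∑ : ∀ {f : Fin n → ℝ} → (∀ i → 0# ≤ f i) → ∀ i → f i ≤ ∑ (allFin n) f
    term≤∑ {n} {f} 0≤f i = begin
      f i                                                   ≈⟨ *-identityʳ (f i) ⟨
      f i * 1#                                              ≈⟨ *-congˡ (∑-δ-allFin n i) ⟨
      f i * ∑ (allFin n) (λ j → ⟦ does (i Fin.≟ j) ⟧)       ≈⟨ *-distribˡ-∑ (f i) (allFin n) (λ j → ⟦ does (i Fin.≟ j) ⟧) ⟩
      ∑ (allFin n) (λ j → f i * ⟦ does (i Fin.≟ j) ⟧)       ≲⟨ ∑-mono-≤ (allFin n) pointwise ⟩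
      ∑ (allFin n) f ∎
      where
      pointwise : ∀ j → f i * ⟦ does (i Fin.≟ j) ⟧ ≤ f j
      pointwise j with i Fin.≟ j
      ... | yes ≡.refl = ≤-reflexive (*-identityʳ _)
      ... | no _       = ≤-trans (≤-reflexive (zeroʳ _)) (0≤f j)

    -- Pulling the double sum back along `τ` eliminates `τ`: the number of pairs left over depends
    -- on the letters alone, so averaging it over the outcomes of a word changes nothing.
    size-push : ∀ (E : Relation n) u τ →
      size (push E u τ) ≈ ∑ (allFin n) (λ i → ∑ (allFin n) λ j → ⟦ E i j ⟧ * ⟦ clash u i j ⟧)
    size-push {n} E u τ = ∑-permute (flip τ) λ i → ∑-permute (flip τ) λ j →
      ⟦∧⟧ (E (τ ⟨$⟩ˡ i) (τ ⟨$⟩ˡ j)) (clash u (τ ⟨$⟩ˡ i) (τ ⟨$⟩ˡ j))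

    -- Diagonal pairs must be kept out of the union bound, because a card with a nonzero letter
    -- clashes with itself.
    Irreflexive : Relation n → Set
    Irreflexive E = ∀ i → E i i ≡ false

    push-irreflexive : ∀ {E : Relation n} u τ → Irreflexive E → Irreflexive (push E u τ)
    push-irreflexive u τ irrefl i = ≡.cong (_∧ clash u (τ ⟨$⟩ˡ i) (τ ⟨$⟩ˡ i)) (irrefl (τ ⟨$⟩ˡ i))

    total : ℕ → Relation n → ℝ
    total {n} k E = ∑ (allPerms n) (Q k E)

    -- The start of the union bound, `1#` being `squares N ^ 0`: an empty `E` gives total 1, and a
    -- nonempty one has size at least 1.
    total-zero : ∀ (E : Relation n) → 1# ≤ total 0 E + size E * 1#
    total-zero {n} E = ≤-trans (bound (Empty? E)) (+-mono-≤ (≤-reflexive (sym total≈)) (≤-reflexive (sym (*-identityʳ _))))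
      where
      total≈ : total 0 E ≈ ⟦ does (Empty? E) ⟧
      total≈ = begin-equality
        ∑ (allPerms n) (λ π → ⟦ does (π ≈ₚ? Perm.id) ⟧ * ⟦ does (Empty? E) ⟧)
          ≈⟨ *-distribʳ-∑ _ (allPerms n) (λ π → ⟦ does (π ≈ₚ? Perm.id) ⟧) ⟨
        ∑ (allPerms n) (λ π → ⟦ does (π ≈ₚ? Perm.id) ⟧) * ⟦ does (Empty? E) ⟧
          ≈⟨ *-congʳ (∑-δ-allPerms n id id) ⟩
        1# * ⟦ does (Empty? E) ⟧
          ≈⟨ *-identityˡ _ ⟩
        ⟦ does (Empty? E) ⟧ ∎
      bound : (empty? : Dec (∀ i j → E i j ≡ false)) → 1# ≤ ⟦ does empty? ⟧ + size E
      bound (yes _)     = x≤x+y (size-nonneg E)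
      bound (no ¬empty) = λ lt → ¬empty λ i j → empty i j (<-respˡ-≈ (+-identityˡ _) lt)
        where
        empty : ∀ i j → size E < 1# → E i j ≡ false
        empty i j size<1 with E i j in Eij
        ... | false = ≡.refl
        ... | true  = contradiction size<1 (≤-trans (≤-reflexive (sym (⟦⟧-cong Eij)))
          (≤-trans (term≤∑ {f = λ j → ⟦ E i j ⟧} (λ j → ⟦⟧-nonneg (E i j)) j)
            (term≤∑ {f = λ i → ∑ (allFin n) λ j → ⟦ E i j ⟧}
              (λ i → ∑-nonneg (allFin n) λ j → ⟦⟧-nonneg (E i j)) i)))

    total-suc : ∀ k (E : Relation n) → total (suc k) E ≈
      𝔼 N n (λ u → ∑ (allPerms n) λ τ → G u τ * total k (push E u τ))
    total-suc {n} k E = begin-equality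
      ∑ (allPerms n) (λ π → ∑ (words N n) λ u → P[ u ] * ∑ (allPerms n) λ τ → term u τ π)
        ≈⟨ ∑-swap (allPerms n) (words N n) (λ π u → P[ u ] * ∑ (allPerms n) λ τ → term u τ π) ⟩
      ∑ (words N n) (λ u → ∑ (allPerms n) λ π → P[ u ] * ∑ (allPerms n) λ τ → term u τ π)
        ≈⟨ ∑-cong (words N n) (λ u → *-distribˡ-∑ P[ u ] (allPerms n) (λ π → ∑ (allPerms n) λ τ → term u τ π)) ⟨
      𝔼 N n (λ u → ∑ (allPerms n) λ π → ∑ (allPerms n) λ τ → term u τ π)
        ≈⟨ 𝔼-cong N n (λ u → trans
             (∑-swap (allPerms n) (allPerms n) (λ π τ → term u τ π))
             (∑-cong (allPerms n) λ τ → trans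
               (sym (*-distribˡ-∑ (G u τ) (allPerms n) (λ π → Q k (push E u τ) (flip τ ∘ₚ π))))
               (*-congˡ (∑-precompose (flip τ) λ π π′ eq →
                 Q-cong k {π = π′} {flip τ ∘ₚ π} (λ _ _ → ≡.refl) (λ j → ≡.sym (eq j)))))) ⟩
      𝔼 N n (λ u → ∑ (allPerms n) λ τ → G u τ * total k (push E u τ)) ∎
      where
      term : Word n → Permutation′ n → Permutation′ n → ℝ
      term u τ π = G u τ * Q k (push E u τ) (flip τ ∘ₚ π)

    -- A union bound over the pairs related by E.
    total-bound : ∀ k (E : Relation n) → Irreflexive E → mass N ≤ 1# →
                  (mass N ^ n) ^ k ≤ total k E + size E * squares N ^ k
    total-bound zero E irrefl mass≤1 = total-zero E
    total-bound {n} (suc k) E irrefl mass≤1 = begin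
      -- `mass N ^ n` is the total mass of one truncated step and takes the place of 1; it is spread
      -- over words here and over their outcomes by `∑-G`.
      mass N ^ n * x
        ≈⟨ *-congʳ (𝔼-one N n) ⟨
      𝔼 N n (λ _ → 1#) * x
        ≈⟨ 𝔼-*ʳ (λ _ → 1#) x ⟩
      𝔼 N n (λ u → 1# * x)
        ≈⟨ 𝔼-cong N n (λ u → trans (*-congʳ (sym (∑-G u))) (*-distribʳ-∑ x (allPerms n) (G u))) ⟩
      𝔼 N n (λ u → ∑ (allPerms n) λ τ → G u τ * x)
        ≲⟨ ∑-mono-≤ (words N n) (λ u → *-monoˡ-≤ (P-nonneg u) (∑-mono-≤ (allPerms n) λ τ →
             *-monoˡ-≤ (G-nonneg u τ) (step u τ))) ⟩
      𝔼 N n (λ u → ∑ (allPerms n) λ τ → G u τ * (total k (push E u τ) + clashes u * sq))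
        ≈⟨ 𝔼-cong N n (λ u → trans (∑-cong (allPerms n) λ τ → distribˡ (G u τ) _ _)
             (trans (∑-distrib-+ (allPerms n) _ _) (+-congˡ
               (trans (sym (*-distribʳ-∑ (clashes u * sq) (allPerms n) (G u)))
                 (trans (*-congʳ (∑-G u)) (*-identityˡ _)))))) ⟩
      𝔼 N n (λ u → (∑ (allPerms n) λ τ → G u τ * total k (push E u τ)) + clashes u * sq)
        ≈⟨ trans (∑-cong (words N n) λ u → distribˡ P[ u ] _ _) (∑-distrib-+ (words N n) _ _) ⟩
      𝔼 N n (λ u → ∑ (allPerms n) λ τ → G u τ * total k (push E u τ)) + 𝔼 N n (λ u → clashes u * sq)
        ≈⟨ +-cong (total-suc k E) (𝔼-*ʳ clashes sq) ⟨
      total (suc k) E + 𝔼 N n clashes * sq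
        ≲⟨ +-mono-≤ ≤-refl (*-monoʳ-≤ (^-nonneg (squares-nonneg N) k) 𝔼-clashes) ⟩
      total (suc k) E + (size E * squares N) * sq
        ≈⟨ +-congˡ (*-assoc (size E) (squares N) sq) ⟩
      total (suc k) E + size E * squares N ^ suc k ∎
      where
      x sq : ℝ
      x = (mass N ^ n) ^ k
      sq = squares N ^ k

      clashes : Word n → ℝ
      clashes u = ∑ (allFin n) λ i → ∑ (allFin n) λ j → ⟦ E i j ⟧ * ⟦ clash u i j ⟧

      step : ∀ u τ → x ≤ total k (push E u τ) + clashes u * sq
      step u τ = ≤-trans (total-bound k (push E u τ) (push-irreflexive {E = E} u τ irrefl) mass≤1)
        (≤-reflexive (+-congˡ (*-congʳ (size-push E u τ))))

      𝔼-*ʳ : ∀ f y → 𝔼 N n f * y ≈ 𝔼 N n (λ u → f u * y)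
      𝔼-*ʳ f y = trans (*-distribʳ-∑ y (words N n) _) (∑-cong (words N n) λ u → *-assoc P[ u ] (f u) y)

      𝔼-∑ : ∀ (f : Word n → Fin n → ℝ) →
        𝔼 N n (λ u → ∑ (allFin n) (f u)) ≈ ∑ (allFin n) λ i → 𝔼 N n λ u → f u i
      𝔼-∑ f = trans (∑-cong (words N n) λ u → *-distribˡ-∑ P[ u ] (allFin n) (f u))
        (∑-swap (words N n) (allFin n) λ u i → P[ u ] * f u i)

      𝔼-pair : ∀ i j → 𝔼 N n (λ u → ⟦ E i j ⟧ * ⟦ clash u i j ⟧) ≤ ⟦ E i j ⟧ * squares N
      𝔼-pair i j with E i j in Eij
      ... | false = ≤-reflexive (trans
        (trans (∑-cong (words N n) λ u → trans (*-congˡ (zeroˡ _)) (zeroʳ _)) (∑-zero (words N n)))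
        (sym (zeroˡ _)))
      ... | true = begin
        𝔼 N n (λ u → 1# * ⟦ clash u i j ⟧)  ≈⟨ 𝔼-cong N n (λ u → *-identityˡ ⟦ clash u i j ⟧) ⟩
        𝔼 N n (λ u → ⟦ clash u i j ⟧)       ≲⟨ 𝔼-clash N mass≤1 n i≢j ⟩
        squares N                           ≈⟨ *-identityˡ (squares N) ⟨
        1# * squares N ∎
        where
        i≢j : i ≢ j
        i≢j ≡.refl with () ← ≡.trans (≡.sym Eij) (irrefl i)

      𝔼-clashes : 𝔼 N n clashes ≤ size E * squares N
      𝔼-clashes = begin
        𝔼 N n clashes
          ≈⟨ 𝔼-∑ (λ u i → ∑ (allFin n) λ j → ⟦ E i j ⟧ * ⟦ clash u i j ⟧) ⟩
        ∑ (allFin n) (λ i → 𝔼 N n λ u → ∑ (allFin n) λ j → ⟦ E i j ⟧ * ⟦ clash u i j ⟧)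
          ≈⟨ ∑-cong (allFin n) (λ i → 𝔼-∑ (λ u j → ⟦ E i j ⟧ * ⟦ clash u i j ⟧)) ⟩
        ∑ (allFin n) (λ i → ∑ (allFin n) λ j → 𝔼 N n λ u → ⟦ E i j ⟧ * ⟦ clash u i j ⟧)
          ≲⟨ ∑-mono-≤ (allFin n) (λ i → ∑-mono-≤ (allFin n) λ j → 𝔼-pair i j) ⟩
        ∑ (allFin n) (λ i → ∑ (allFin n) λ j → ⟦ E i j ⟧ * squares N)
          ≈⟨ ∑-cong (allFin n) (λ i → *-distribʳ-∑ (squares N) (allFin n) (λ j → ⟦ E i j ⟧)) ⟨
        ∑ (allFin n) (λ i → (∑ (allFin n) λ j → ⟦ E i j ⟧) * squares N)
          ≈⟨ *-distribʳ-∑ (squares N) (allFin n) (λ i → ∑ (allFin n) λ j → ⟦ E i j ⟧) ⟨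
        size E * squares N ∎

    Q≤power : ∀ k (E : Relation n) π → Q k E π ≤ power W k π
    Q≤power zero E π with does (Empty? E)
    ... | true  = ≤-reflexive (*-identityʳ _)
    ... | false = ≤-trans (≤-reflexive (zeroʳ _)) (⟦⟧-nonneg (does (π ≈ₚ? Perm.id)))
    Q≤power {n} (suc k) E π = begin
      𝔼 N n (λ u → ∑ (allPerms n) λ τ → G u τ * Q k (push E u τ) (flip τ ∘ₚ π))
        ≲⟨ ∑-mono-≤ (words N n) (λ u → *-monoˡ-≤ (P-nonneg u) (∑-mono-≤ (allPerms n) λ τ →
             *-monoˡ-≤ (G-nonneg u τ) (Q≤power k (push E u τ) (flip τ ∘ₚ π)))) ⟩
      𝔼 N n (λ u → ∑ (allPerms n) λ τ → G u τ * power W k (flip τ ∘ₚ π))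
        ≈⟨ ∑-cong (words N n) (λ u → trans
             (*-distribˡ-∑ P[ u ] (allPerms n) (λ τ → G u τ * power W k (flip τ ∘ₚ π)))
             (∑-cong (allPerms n) λ τ → sym (*-assoc P[ u ] (G u τ) _))) ⟩
      ∑ (words N n) (λ u → ∑ (allPerms n) λ τ → P[ u ] * G u τ * power W k (flip τ ∘ₚ π))
        ≈⟨ ∑-swap (words N n) (allPerms n) (λ u τ → P[ u ] * G u τ * power W k (flip τ ∘ₚ π)) ⟩
      ∑ (allPerms n) (λ τ → ∑ (words N n) λ u → P[ u ] * G u τ * power W k (flip τ ∘ₚ π))
        ≈⟨ ∑-cong (allPerms n) (λ τ → *-distribʳ-∑ (power W k (flip τ ∘ₚ π)) (words N n) (λ u → P[ u ] * G u τ)) ⟨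
      power W (suc k) π ∎

    -- The total of a constant weight is `n !` times its value at `π`, which turns the union bound
    -- into a bound at each permutation. Forgetting the separation requirement then only increases
    -- the right side.
    ⋆^-bound : ∀ n k (π : Permutation′ n) → mass N ≤ 1# →
      (mass N ^ n) ^ k ≤ (W ⋆^ k) π * fromℕ (n !) + fromℕ (n C 2) * squares N ^ k
    ⋆^-bound n k π mass≤1 = begin
      (mass N ^ n) ^ k
        ≲⟨ total-bound k (ascending n) (λ i → dec-false (i Fin.<? i) (ℕ.<-irrefl ≡.refl)) mass≤1 ⟩
      total k (ascending n) + size (ascending n) * squares N ^ k
        ≈⟨ +-cong total-const (*-congʳ (size-ascending n)) ⟩
      Q k (ascending n) π * fromℕ (n !) + fromℕ (n C 2) * squares N ^ k
        ≲⟨ +-monoˡ-≤ _ (*-monoʳ-≤ (fromℕ-nonneg (n !))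
             (≤-trans (Q≤power k (ascending n) π) (≤-reflexive (sym (⋆^≈power W k π))))) ⟩
      (W ⋆^ k) π * fromℕ (n !) + fromℕ (n C 2) * squares N ^ k ∎
      where
      total-const : total k (ascending n) ≈ Q k (ascending n) π * fromℕ (n !)
      total-const = begin-equality
        ∑ (allPerms n) (Q k (ascending n))
          ≈⟨ ∑-cong (allPerms n) (λ σ → trans (Q-constant n k σ)
               (trans (sym (Q-constant n k π)) (sym (*-identityʳ _)))) ⟩
        ∑ (allPerms n) (λ _ → Q k (ascending n) π * 1#)
          ≈⟨ *-distribˡ-∑ (Q k (ascending n) π) (allPerms n) (λ _ → 1#) ⟨
        Q k (ascending n) π * ∑ (allPerms n) (λ _ → 1#)
          ≡⟨ ≡.cong (Q k (ascending n) π *_) (≡.trans (∑-const (allPerms n)) (≡.cong fromℕ (length-allPerms n))) ⟩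
        Q k (ascending n) π * fromℕ (n !) ∎

-- The bound in the limit of all letters, and the logarithm

2*nC2≤n*n : ∀ n → 2 ℕ.* (n C 2) ℕ.≤ n ℕ.* n
2*nC2≤n*n zero    = ℕ.z≤n
2*nC2≤n*n (suc n) = begin
  2 ℕ.* (suc n C 2)              ≡⟨ ≡.cong (2 ℕ.*_) (nCk+nC[k+1]≡[n+1]C[k+1] n 1) ⟨
  2 ℕ.* (n C 1 ℕ.+ n C 2)        ≡⟨ ≡.cong (λ k → 2 ℕ.* (k ℕ.+ n C 2)) (nC1≡n n) ⟩
  2 ℕ.* (n ℕ.+ n C 2)            ≡⟨ ℕ.*-distribˡ-+ 2 n (n C 2) ⟩
  2 ℕ.* n ℕ.+ 2 ℕ.* (n C 2)      ≤⟨ ℕ.+-monoʳ-≤ (2 ℕ.* n) (2*nC2≤n*n n) ⟩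
  2 ℕ.* n ℕ.+ n ℕ.* n            ≤⟨ ℕ.n≤1+n _ ⟩
  suc (2 ℕ.* n ℕ.+ n ℕ.* n)      ≡⟨ square n ⟩
  suc n ℕ.* suc n ∎
  where
  open ℕ.≤-Reasoning
  square : ∀ n → suc (2 ℕ.* n ℕ.+ n ℕ.* n) ≡ suc n ℕ.* suc n
  square = solve-∀

module SeparationBound {c ℓ₁ ℓ₂} (R : RealField c ℓ₁ ℓ₂) where
  open RealField R hiding (zero)
  open Shuffles R
  open RealFieldProperties R
  open ListSum (RealField.commutativeSemiring R)
  open WordEnumeration (RealField.commutativeSemiring R)
  open FiniteAlphabet R
  open Separation R
  open PreorderReasoning ≤-preorder
  open Solver (RealField.commutativeSemiring R) using (solve; _:=_; _:+_)
  open Exp semiring using (^-homo-*; ^-assocʳ; ^-congˡ)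
  open CommutativeExp (RealField.commutativeSemiring R) using (^-distrib-*)

  sum≈∑ : ∀ N f → sum {N} (f ∘ toℕ) ≈ ∑ (upTo N) f
  sum≈∑ zero    f = refl
  sum≈∑ (suc N) f = trans (+-congˡ (sum≈∑ N (f ∘ suc))) (sym (reflexive (∑-upTo-suc N f)))

  module _ {f : ℕ → ℝ} (0≤f : ∀ i → 0# ≤ f i) where

    ∑-upTo-mono : ∀ N → ∑ (upTo N) f ≤ ∑ (upTo (suc N)) f
    ∑-upTo-mono N = ≤-trans (x≤x+y (0≤f N)) (≤-reflexive (sym (∑-upTo-∷ʳ N f)))

    ∑-upTo≤sum : ∀ {s} → HasSum f s → ∀ N → ∑ (upTo N) f ≤ s
    ∑-upTo≤sum has-sum N = ≤-trans (≤-reflexive (sym (sum≈∑ N f)))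
      (monotone⇒≤limit (λ N → ≤-trans (≤-reflexive (sum≈∑ N f))
        (≤-trans (∑-upTo-mono N) (≤-reflexive (sym (sum≈∑ (suc N) f))))) has-sum N)

  ∑-letters-mono : ∀ N {f} → (∀ x → 0# ≤ f x) → ∑ (letters N) f ≤ ∑ (letters (suc N)) f
  ∑-letters-mono N {f} 0≤f = begin
    ∑ (letters N) f
      ≈⟨ ∑-letters N f ⟩
    f 0ℤ + (∑ (upTo N) (f ∘ +[1+_]) + ∑ (upTo N) (f ∘ -[1+_]))
      ≲⟨ +-mono-≤ ≤-refl (+-mono-≤ (∑-upTo-mono (0≤f ∘ +[1+_]) N) (∑-upTo-mono (0≤f ∘ -[1+_]) N)) ⟩
    f 0ℤ + (∑ (upTo (suc N)) (f ∘ +[1+_]) + ∑ (upTo (suc N)) (f ∘ -[1+_]))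
      ≈⟨ ∑-letters (suc N) f ⟨
    ∑ (letters (suc N)) f ∎

  ∑-words-mono : ∀ N n {f} → (∀ u → 0# ≤ f u) → ∑ (words N n) f ≤ ∑ (words (suc N) n) f
  ∑-words-mono N zero        0≤f = ≤-refl
  ∑-words-mono N (suc n) {f} 0≤f = begin
    ∑ (words N (suc n)) f
      ≈⟨ ∑-cartesianProductWith Vector._∷_ (letters N) (words N n) f ⟩
    ∑ (letters N) (λ x → ∑ (words N n) λ u → f (x Vector.∷ u))
      ≲⟨ ∑-letters-mono N (λ x → ∑-nonneg (words N n) λ u → 0≤f (x Vector.∷ u)) ⟩
    ∑ (letters (suc N)) (λ x → ∑ (words N n) λ u → f (x Vector.∷ u))
      ≲⟨ ∑-mono-≤ (letters (suc N)) (λ x → ∑-words-mono N n λ u → 0≤f (x Vector.∷ u)) ⟩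
    ∑ (letters (suc N)) (λ x → ∑ (words (suc N) n) λ u → f (x Vector.∷ u))
      ≈⟨ ∑-cartesianProductWith Vector._∷_ (letters (suc N)) (words (suc N) n) f ⟨
    ∑ (words (suc N) (suc n)) f ∎

  module _ {P : Weight n} (0≤P : ∀ π → 0# ≤ P π) where

    ⋆^-nonneg : ∀ k π → 0# ≤ (P ⋆^ k) π
    ⋆^-nonneg zero π with does (π ≈ₚ? Perm.id)
    ... | true  = 0≤1
    ... | false = ≤-refl
    ⋆^-nonneg (suc k) π = ∑-nonneg (allPerms n) λ σ → *-nonneg (0≤P σ) (⋆^-nonneg k _)

  ⋆^-mono : ∀ {P Q : Weight n} → (∀ π → 0# ≤ P π) → (∀ π → P π ≤ Q π) →
            ∀ k π → (P ⋆^ k) π ≤ (Q ⋆^ k) π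
  ⋆^-mono     0≤P P≤Q zero    π = ≤-refl
  ⋆^-mono {n} 0≤P P≤Q (suc k) π = ∑-mono-≤ (allPerms n) λ σ →
    *-mono-≤ (⋆^-nonneg 0≤P k _) (≤-trans (0≤P σ) (P≤Q σ)) (P≤Q σ) (⋆^-mono 0≤P P≤Q k _)

  recip-uniform : ∀ n (π : Permutation′ n) → recip (uniform>0 n π) ≈ fromℕ (n !)
  recip-uniform n π = begin-equality
    recip (uniform>0 n π)
      ≈⟨ *-identityˡ _ ⟨
    1# * recip (uniform>0 n π)
      ≈⟨ *-congʳ (*-recip (!>0 n)) ⟨
    fromℕ (n !) * recip (!>0 n) * recip (uniform>0 n π)
      ≈⟨ trans (*-assoc _ _ _) (*-congˡ (*-recip (uniform>0 n π))) ⟩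
    fromℕ (n !) * 1#
      ≈⟨ *-identityʳ _ ⟩
    fromℕ (n !) ∎

  separation-≤ : ∀ (P : Weight n) {y} → (∀ π → 1# ≤ P π * fromℕ (n !) + y) → separation P ≤ y
  separation-≤ {n} P {y} 1≤ = foldr-≤ (allPerms n) deficit≤
    where
    foldr-≤ : ∀ {f : Weight n} πs → (∀ π → f π ≤ y) →
              List.foldr (λ π → f π ∨_) (f Perm.id) πs ≤ y
    foldr-≤ []       f≤y = f≤y Perm.id
    foldr-≤ (π ∷ πs) f≤y = proj₂ (proj₂ (∨-supremum _ _)) y (f≤y π) (foldr-≤ πs f≤y)
    deficit≤ : ∀ π → 1# - P π * recip (uniform>0 n π) ≤ y
    deficit≤ π = +-cancelʳ-≤ (P π * recip (uniform>0 n π)) (begin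
      1# - P π * recip (uniform>0 n π) + P π * recip (uniform>0 n π)
        ≈⟨ [x-y]+y _ _ ⟩
      1#
        ≲⟨ 1≤ π ⟩
      P π * fromℕ (n !) + y
        ≈⟨ trans (+-comm _ _) (+-congˡ (*-congˡ (sym (recip-uniform n π)))) ⟩
      y + P π * recip (uniform>0 n π) ∎)

  module _ (α β : ℕ → ℝ) (γ A B A₂ B₂ : ℝ)
           (0≤α : ∀ i → 0# ≤ α i) (0≤β : ∀ i → 0# ≤ β i) (0≤γ : 0# ≤ γ)
           (sum-α : HasSum α A) (sum-β : HasSum β B) (total≈1 : γ + A + B ≈ 1#)
           (sum-α² : HasSum (λ i → α i ^ 2) A₂) (sum-β² : HasSum (λ i → β i ^ 2) B₂) where

    open Words α β γ 0≤α 0≤β 0≤γ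
    open Truncated α β γ 0≤α 0≤β 0≤γ using (W; G-nonneg; ⋆^-bound)

    mass≤1 : ∀ N → mass N ≤ 1#
    mass≤1 N = begin
      mass N                                          ≈⟨ ∑-letters N p ⟩
      γ + (∑ (upTo N) α + ∑ (upTo N) β)               ≲⟨ +-mono-≤ ≤-refl
        (+-mono-≤ (∑-upTo≤sum 0≤α sum-α N) (∑-upTo≤sum 0≤β sum-β N)) ⟩
      γ + (A + B)                                     ≈⟨ +-assoc γ A B ⟨
      γ + A + B                                       ≈⟨ total≈1 ⟩
      1# ∎

    -- One `ε` pays for the tail of `α`, the other for the tail of `β`.
    mass→1 : ∀ ε → 0# < ε → ∃[ N ] 1# ≤ mass N + (ε + ε)
    mass→1 ε 0<ε with M , boundα ← sum-α ε 0<ε | M′ , boundβ ← sum-β ε 0<ε = N , (begin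
      1#                                                            ≈⟨ trans (sym total≈1) (+-assoc γ A B) ⟩
      γ + (A + B)
        ≲⟨ +-mono-≤ ≤-refl (+-mono-≤
             (<⇒≤ (proj₁ (boundα N (ℕ.m≤m⊔n M M′)))) (<⇒≤ (proj₁ (boundβ N (ℕ.m≤n⊔m M M′))))) ⟩
      γ + (sum {N} (α ∘ toℕ) + ε + (sum {N} (β ∘ toℕ) + ε))
        ≈⟨ +-congˡ (+-cong (+-congʳ (sum≈∑ N α)) (+-congʳ (sum≈∑ N β))) ⟩
      γ + (∑ (upTo N) α + ε + (∑ (upTo N) β + ε))
        ≈⟨ solve 4 (λ c a b e → c :+ (a :+ e :+ (b :+ e)) := c :+ (a :+ b) :+ (e :+ e)) refl
             γ (∑ (upTo N) α) (∑ (upTo N) β) ε ⟩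
      γ + (∑ (upTo N) α + ∑ (upTo N) β) + (ε + ε)                   ≈⟨ +-congʳ (∑-letters N p) ⟨
      mass N + (ε + ε) ∎)
      where
      N : ℕ
      N = M ℕ.⊔ M′

    squares≤ : ∀ N → squares N ≤ A₂ + B₂
    squares≤ N = +-mono-≤ (∑-upTo≤sum (λ i → ^-nonneg (0≤α i) 2) sum-α² N)
      (∑-upTo≤sum (λ i → ^-nonneg (0≤β i) 2) sum-β² N)

    module _ (n : ℕ) (P : Weight n) (shuffle : IsShuffle α β γ n P) where

      W-nonneg : ∀ N π → 0# ≤ W N π
      W-nonneg N π = 𝔼-nonneg N n λ u → G-nonneg N u π

      W≤P : ∀ N π → W N π ≤ P π
      W≤P N π = monotone⇒≤limit (λ N → ∑-words-mono N n λ u →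
        *-nonneg (P-nonneg u) (G-nonneg N u π)) (shuffle π) N

      ⋆^-lower : ∀ k π → 1# ≤ (P ⋆^ k) π * fromℕ (n !) + fromℕ (n C 2) * (A₂ + B₂) ^ k
      ⋆^-lower k π = ≤-closed (e ℕ.+ e) bound
        where
        -- The number of letters drawn in `k` steps. Each costs at most `ε + ε`, whence `e ℕ.+ e` as
        -- the multiple of `ε`.
        e : ℕ
        e = n ℕ.* k
        bound : ∀ ε → 0# < ε → 1# ≤
          (P ⋆^ k) π * fromℕ (n !) + fromℕ (n C 2) * (A₂ + B₂) ^ k + fromℕ (e ℕ.+ e) * ε
        bound ε 0<ε with N , 1≤mass+2ε ← mass→1 ε 0<ε = begin
          1#
            ≲⟨ bernoulli-≤1 (mass-nonneg N) (mass≤1 N) (+-nonneg (<⇒≤ 0<ε) (<⇒≤ 0<ε)) 1≤mass+2ε e ⟩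
          mass N ^ e + fromℕ e * (ε + ε)
            ≈⟨ +-cong (sym (^-assocʳ (mass N) n k)) (trans (trans (distribˡ _ ε ε) (sym (distribʳ ε _ _)))
                 (*-congʳ (sym (fromℕ-+ e e)))) ⟩
          (mass N ^ n) ^ k + fromℕ (e ℕ.+ e) * ε
            ≲⟨ +-monoˡ-≤ _ (⋆^-bound N n k π (mass≤1 N)) ⟩
          (W N ⋆^ k) π * fromℕ (n !) + fromℕ (n C 2) * squares N ^ k + fromℕ (e ℕ.+ e) * ε
            ≲⟨ +-monoˡ-≤ _ (+-mono-≤
                 (*-monoʳ-≤ (fromℕ-nonneg (n !)) (⋆^-mono (W-nonneg N) (W≤P N) k π))
                 (*-monoˡ-≤ (fromℕ-nonneg (n C 2)) (^-mono-≤ (squares-nonneg N) (squares≤ N) k))) ⟩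
          (P ⋆^ k) π * fromℕ (n !) + fromℕ (n C 2) * (A₂ + B₂) ^ k + fromℕ (e ℕ.+ e) * ε ∎

      separation-bound : ∀ k → separation (P ⋆^ k) ≤ fromℕ (n C 2) * (A₂ + B₂) ^ k
      separation-bound k = separation-≤ (P ⋆^ k) (⋆^-lower k)

  -- The logarithm and the number of steps

  1^n≈1 : ∀ n → 1# ^ n ≈ 1#
  1^n≈1 zero    = refl
  1^n≈1 (suc n) = trans (*-identityˡ _) (1^n≈1 n)

  ^-pos : ∀ {x} → 0# < x → ∀ n → 0# < x ^ n
  ^-pos 0<x zero    = 0<1
  ^-pos 0<x (suc n) = *-pos 0<x (^-pos 0<x n)

  -- Otherwise x * x is a factor 1 + ε larger than b ^ d; a power (1 + ε) ^ q
  -- exceeds b, and then (d * q + 1) / (2 * q) > L is a lower bound of the logarithm.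
  log-bound : ∀ {b x L} → 0# < b → IsLog b x L → ∀ d → fromℕ 2 * L ≤ fromℕ d → x * x ≤ b ^ d
  log-bound {b} {x} {L} 0<b isLog d 2L≤d y<xx =
    ℕ.<-irrefl ≡.refl (fromℕ-cancel-≤ {suc (d ℕ.* q)} {d ℕ.* q} 1+dq≤dq)
    where
    y ε : ℝ
    y = b ^ d
    0<y : 0# < y
    0<y = ^-pos 0<b d
    ε = (x * x - y) * recip 0<y
    0<ε : 0# < ε
    0<ε = *-pos (0<y-x y<xx) (recip>0 0<y)
    large : ∃[ Q ] b * recip 0<ε < fromℕ Q
    large = archimedean (b * recip 0<ε)
    -- The successor makes `2 ℕ.* q` visibly nonzero, as a denominator must be.
    q : ℕ
    q = suc (proj₁ large)

    [1+ε]y : (1# + ε) * y ≈ x * x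
    [1+ε]y = begin-equality
      (1# + ε) * y                              ≈⟨ distribʳ y 1# ε ⟩
      1# * y + (x * x - y) * recip 0<y * y      ≈⟨ +-cong (*-identityˡ y) (trans (*-assoc _ _ _)
        (trans (*-congˡ (trans (*-comm _ y) (*-recip 0<y))) (*-identityʳ _))) ⟩
      y + (x * x - y)                           ≈⟨ trans (+-comm y _) ([x-y]+y (x * x) y) ⟩
      x * x ∎

    b≤[1+ε]^q : b ≤ (1# + ε) ^ q
    b≤[1+ε]^q = begin
      b                           ≈⟨ trans (*-assoc b _ ε) (trans (*-congˡ (trans (*-comm _ ε) (*-recip 0<ε))) (*-identityʳ b)) ⟨
      b * recip 0<ε * ε           ≲⟨ *-monoʳ-≤ (<⇒≤ 0<ε) (≤-trans (<⇒≤ (proj₂ large)) (fromℕ-mono-≤ (ℕ.n≤1+n (proj₁ large)))) ⟩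
      fromℕ q * ε                 ≲⟨ x≤x+y 0≤1 ⟩
      fromℕ q * ε + 1#            ≈⟨ +-comm _ 1# ⟩
      1# + fromℕ q * ε            ≲⟨ bernoulli (<⇒≤ 0<ε) q ⟩
      (1# + ε) ^ q ∎

    b^p≤x^2q : b ^ suc (d ℕ.* q) ≤ x ^ (2 ℕ.* q)
    b^p≤x^2q = begin
      b * b ^ (d ℕ.* q)         ≈⟨ *-congˡ (^-assocʳ b d q) ⟨
      b * y ^ q                 ≲⟨ *-monoʳ-≤ (^-nonneg (<⇒≤ 0<y) q) b≤[1+ε]^q ⟩
      (1# + ε) ^ q * y ^ q      ≈⟨ ^-distrib-* (1# + ε) y q ⟨
      ((1# + ε) * y) ^ q        ≈⟨ ^-congˡ q (trans [1+ε]y (*-congˡ (sym (*-identityʳ x)))) ⟩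
      (x ^ 2) ^ q               ≈⟨ ^-assocʳ x 2 q ⟩
      x ^ (2 ℕ.* q) ∎

    1+dq≤dq : fromℕ (suc (d ℕ.* q)) ≤ fromℕ (d ℕ.* q)
    1+dq≤dq = begin
      fromℕ p                                        ≈⟨ *-identityʳ _ ⟨
      fromℕ p * 1#                                   ≈⟨ *-congˡ (trans (*-comm _ _) (*-recip (fromℕ>0 (2 ℕ.* q)))) ⟨
      fromℕ p * (1/ (2 ℕ.* q) * fromℕ (2 ℕ.* q))     ≈⟨ *-assoc _ _ _ ⟨
      fromℕ p * 1/ (2 ℕ.* q) * fromℕ (2 ℕ.* q)       ≲⟨ *-monoʳ-≤ (fromℕ-nonneg (2 ℕ.* q)) (proj₁ isLog p (2 ℕ.* q) b^p≤x^2q) ⟩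
      L * fromℕ (2 ℕ.* q)                            ≈⟨ trans (*-congˡ (fromℕ-* 2 q)) (trans (sym (*-assoc _ _ _)) (*-congʳ (*-comm L _))) ⟩
      fromℕ 2 * L * fromℕ q                          ≲⟨ *-monoʳ-≤ (fromℕ-nonneg q) 2L≤d ⟩
      fromℕ d * fromℕ q                              ≈⟨ fromℕ-* d q ⟨
      fromℕ (d ℕ.* q) ∎
      where
      p : ℕ
      p = suc (d ℕ.* q)

  -- The fraction 0 / 1 is among those of which the logarithm is the supremum.
  log-nonneg : ∀ {b x L} → IsLog b x L → 1# ≤ x → 0# ≤ L
  log-nonneg isLog 1≤x = ≤-trans (≤-reflexive (sym (zeroˡ (1/ 1))))
    (proj₁ isLog 0 1 (≤-trans 1≤x (≤-reflexive (sym (*-identityʳ _)))))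

  -- Of the `k` steps, `d = k ∸ m` number at least `2L`, and by `log-bound` they shrink `S ^ d`
  -- enough to cancel `n * n`. The factor `1/ 2` is what remains of `n C 2` after comparison with
  -- `n * n`, and the `m` surplus steps give `S ^ m`.
  log-steps : ∀ {S} n → 1 ℕ.≤ n → (0<S : 0# < S) → ∀ L → IsLog (recip 0<S) (fromℕ n) L →
              ∀ k m → fromℕ 2 * L + fromℕ m ≤ fromℕ k →
              fromℕ (n C 2) * S ^ k ≤ S ^ m * 1/ 2
  log-steps {S} n 1≤n 0<S L isLog k m 2L+m≤k = begin
    fromℕ (n C 2) * S ^ k              ≡⟨ ≡.cong (λ k → fromℕ (n C 2) * S ^ k) m+d≡k ⟨
    fromℕ (n C 2) * S ^ (m ℕ.+ d)      ≈⟨ *-congˡ (^-homo-* S m d) ⟩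
    fromℕ (n C 2) * (S ^ m * S ^ d)    ≈⟨ trans (sym (*-assoc _ _ _)) (trans (*-congʳ (*-comm _ _)) (*-assoc _ _ _)) ⟩
    S ^ m * (fromℕ (n C 2) * S ^ d)    ≲⟨ *-monoˡ-≤ (^-nonneg (<⇒≤ 0<S) m) C*S^d≤½ ⟩
    S ^ m * 1/ 2 ∎
    where
    b : ℝ
    b = recip 0<S
    0≤2L : 0# ≤ fromℕ 2 * L
    0≤2L = *-nonneg (fromℕ-nonneg 2) (log-nonneg isLog
      (≤-trans (≤-reflexive (sym (+-identityʳ 1#))) (fromℕ-mono-≤ 1≤n)))
    m≤k : m ℕ.≤ k
    m≤k = fromℕ-cancel-≤ (≤-trans (≤-trans (x≤x+y 0≤2L) (≤-reflexive (+-comm _ _))) 2L+m≤k)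
    d : ℕ
    d = k ℕ.∸ m
    m+d≡k : m ℕ.+ d ≡ k
    m+d≡k = ℕ.m+[n∸m]≡n m≤k
    2L≤d : fromℕ 2 * L ≤ fromℕ d
    2L≤d = +-cancelʳ-≤ (fromℕ m) (≤-trans 2L+m≤k (≤-reflexive (trans
      (reflexive (≡.cong fromℕ (≡.sym m+d≡k))) (trans (fromℕ-+ m d) (+-comm _ _)))))
    C*S^d≤½ : fromℕ (n C 2) * S ^ d ≤ 1/ 2
    C*S^d≤½ = *-cancelˡ-≤ (fromℕ>0 2) (begin
      fromℕ 2 * (fromℕ (n C 2) * S ^ d)      ≈⟨ *-assoc _ _ _ ⟨
      fromℕ 2 * fromℕ (n C 2) * S ^ d        ≈⟨ *-congʳ (fromℕ-* 2 (n C 2)) ⟨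
      fromℕ (2 ℕ.* (n C 2)) * S ^ d          ≲⟨ *-monoʳ-≤ 0≤S^d (fromℕ-mono-≤ (2*nC2≤n*n n)) ⟩
      fromℕ (n ℕ.* n) * S ^ d                ≈⟨ *-congʳ (fromℕ-* n n) ⟩
      fromℕ n * fromℕ n * S ^ d              ≲⟨ *-monoʳ-≤ 0≤S^d (log-bound (recip>0 0<S) isLog d 2L≤d) ⟩
      b ^ d * S ^ d                          ≈⟨ ^-distrib-* b S d ⟨
      (b * S) ^ d                            ≈⟨ ^-congˡ d (trans (*-comm b S) (*-recip 0<S)) ⟩
      1# ^ d                                 ≈⟨ 1^n≈1 d ⟩
      1#                                     ≈⟨ *-recip (fromℕ>0 2) ⟨
      fromℕ 2 * 1/ 2 ∎)
      where
      0≤S^d : 0# ≤ S ^ d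
      0≤S^d = ^-nonneg (<⇒≤ 0<S) d

-- The second part makes "close" quantitative: at `2L` steps the bound is one half, and every
-- further step multiplies it by `A₂ + B₂`. Since `2L` is real and the number of steps an integer,
-- any `k` beyond `2L + m` is allowed.
theorem8 : ∀ {c ℓ₁ ℓ₂} (R : RealField c ℓ₁ ℓ₂) →
    let open RealField R
        open Shuffles R
    in
    (α β : ℕ → ℝ) (γ A B A₂ B₂ : ℝ) →
    (∀ i → 0# ≤ α i) → (∀ i → 0# ≤ β i) → 0# ≤ γ →
    HasSum α A → HasSum β B → γ + A + B ≈ 1# →
    HasSum (λ i → α i ^ 2) A₂ → HasSum (λ i → β i ^ 2) B₂ →
    (n : ℕ) (P : Weight n) → IsShuffle α β γ n P →
    (∀ k → separation (P ⋆^ k) ≤ fromℕ (n C 2) * (A₂ + B₂) ^ k)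
    ×
    (1 ℕ.≤ n → (0<S : 0# < A₂ + B₂) → A₂ + B₂ < 1# →
     (L : ℝ) → IsLog (recip 0<S) (fromℕ n) L →
     ∀ k m → fromℕ 2 * L + fromℕ m ≤ fromℕ k →
     separation (P ⋆^ k) ≤ (A₂ + B₂) ^ m * 1/ 2)
theorem8 R α β γ A B A₂ B₂ 0≤α 0≤β 0≤γ sum-α sum-β total≈1 sum-α² sum-β² n P shuffle =
  bound , λ 1≤n 0<S _ L isLog k m 2L+m≤k → ≤-trans (bound k) (log-steps n 1≤n 0<S L isLog k m 2L+m≤k)
  where
  open SeparationBound R
  open RealFieldProperties R using (≤-trans)
  bound = separation-bound α β γ A B A₂ B₂ 0≤α 0≤β 0≤γ sum-α sum-β total≈1 sum-α² sum-β² n P shuffle
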